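{- Let $k \ge 2$ be an integer, let $q(k) = \left\lfloor \frac{ -1+\sqrt{8k-7}}{2} \right\rfloor$, and let $G$ be a $k$-tree on $n \ge k+q(k)+2$ vertices. Then $$\alpha_{\rm reg}(G) > \frac{24k}{48k^3 + 84k^2 - 72k - (16k^2-13)\sqrt{8k-7} + 36}\; n.$$
   Context: Graphs are finite and simple. For a graph $G$, $\alpha_{\rm reg}(G)$ denotes the regular independence number: the maximum cardinality of an independent set of $G$ all of whose vertices have the same degree in $G$. A $k$-tree is a graph obtained by starting with a complete graph $K_{k+1}$ and then repeatedly (zero or more times) adding a new vertex whose neighborhood, at the time it is added, consists of exactly $k$ vertices that form a clique. -}

module Defs where

open import Data.Bool.Base using (Bool; true; false)
import Data.Bool.Properties as Bool
open import Data.Fin.Base using (Fin; punchIn)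
open import Data.Fin.Properties using (all?)
open import Data.Fin.Subset using (Subset; inside; outside; _∈_; ∣_∣)
open import Data.Fin.Subset.Properties using (_∈?_)
open import Data.Integer.Base as ℤ using (ℤ; +_)
import Data.Integer.Properties as ℤ
open import Data.List.Base as List using (List; []; _∷_; _++_; filter)
open import Data.List.Extrema.Nat using (max)
open import Data.Nat.Base as ℕ using (ℕ; zero; suc; _∸_; _^_; z≤n; s≤s)
import Data.Nat.Properties as ℕ
open import Data.Nat.Tactic.RingSolver using (solve-∀)
open import Data.Product.Base using (∃; _×_; _,_)
open import Data.Rational.Base as ℚ using (ℚ; 0ℚ; 1ℚ; ½)
import Data.Rational.Properties as ℚ
open import Data.Rational.Unnormalised.Base as ℚᵘ using (mkℚᵘ)
import Data.Rational.Unnormalised.Properties as ℚᵘ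
open import Data.Rational.Solver using (module +-*-Solver)
open import Data.Sum.Base using (_⊎_; inj₁; inj₂)
open import Data.Vec.Base using (tabulate; []; _∷_)
open import Relation.Binary.PropositionalEquality
open import Relation.Nullary using (Dec; yes; no; ¬_; contradiction; _×-dec_; _→-dec_)
open import Relation.Unary using (Decidable)

private variable
  n : ℕ

record Graph (n : ℕ) : Set where
  field
    adj     : Fin n → Fin n → Bool
    symm    : ∀ u v → adj u v ≡ adj v u
    irrefl  : ∀ v → adj v v ≡ false

open Graph public

neighbours : Graph n → Fin n → Subset n
neighbours G v = tabulate (adj G v)

degree : Graph n → Fin n → ℕ
degree G v = ∣ neighbours G v ∣

IsClique : Graph n → Subset n → Set
IsClique G S = ∀ u v → u ∈ S → v ∈ S → u ≢ v → adj G u v ≡ true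

IsIndependent : Graph n → Subset n → Set
IsIndependent G S = ∀ u v → u ∈ S → v ∈ S → adj G u v ≡ false

IsRegular : Graph n → Subset n → Set
IsRegular G S = ∀ u v → u ∈ S → v ∈ S → degree G u ≡ degree G v

IsRegularIndependent : Graph n → Subset n → Set
IsRegularIndependent G S = IsIndependent G S × IsRegular G S

isRegularIndependent? : (G : Graph n) → Decidable (IsRegularIndependent G)
isRegularIndependent? G S = independent? ×-dec regular?
  where
  independent? : Dec (IsIndependent G S)
  independent? = all? λ u → all? λ v →
    u ∈? S →-dec v ∈? S →-dec adj G u v Bool.≟ false

  regular? : Dec (IsRegular G S)
  regular? = all? λ u → all? λ v →
    u ∈? S →-dec v ∈? S →-dec degree G u ℕ.≟ degree G v

subsets : ∀ n → List (Subset n)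
subsets zero    = [] ∷ []
subsets (suc n) =
  List.map (inside ∷_) (subsets n) ++ List.map (outside ∷_) (subsets n)

-- The default 0 in `max` is the cardinality of the empty set, which always
-- qualifies.
αreg : Graph n → ℕ
αreg {n} G =
  max 0 (List.map ∣_∣ (filter (isRegularIndependent? G) (subsets n)))

-- The remaining vertices are relabelled order-preservingly.
_-ᵛ_ : Graph (suc n) → Fin (suc n) → Graph n
adj    (G -ᵛ v) x y = adj G (punchIn v x) (punchIn v y)
symm   (G -ᵛ v) x y = symm G (punchIn v x) (punchIn v y)
irrefl (G -ᵛ v) x   = irrefl G (punchIn v x)

-- In `add`, the graph G arises from the k-tree G -ᵛ v by adding the vertex v.
-- Since v may carry any label, every labelling of a k-tree by Fin n is covered.
data IsKTree (k : ℕ) : ∀ {n} → Graph n → Set where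
  complete : (G : Graph (suc k)) →
             (∀ u v → u ≢ v → adj G u v ≡ true) →
             IsKTree k G
  add      : (G : Graph (suc n)) (v : Fin (suc n)) →
             IsKTree k (G -ᵛ v) →
             ∣ neighbours G v ∣ ≡ k →
             IsClique G (neighbours G v) →
             IsKTree k G

IsCauchy : (ℕ → ℚ) → Set
IsCauchy s = ∀ ε → 0ℚ ℚ.< ε → ∃ λ N → ∀ m n → N ℕ.≤ m → N ℕ.≤ n →
             ℚ.∣ s m ℚ.- s n ∣ ℚ.≤ ε

record ℝ : Set where
  field
    seq    : ℕ → ℚ
    cauchy : IsCauchy seq

open ℝ public

infix 4 _<ʳ_ _≤ʳ_ _#_

_<ʳ_ : ℝ → ℝ → Set
x <ʳ y = ∃ λ ε → 0ℚ ℚ.< ε × ∃ λ N → ∀ m → N ℕ.≤ m →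
         seq x m ℚ.+ ε ℚ.≤ seq y m

_≤ʳ_ : ℝ → ℝ → Set
x ≤ʳ y = ¬ (y <ʳ x)

_#_ : ℝ → ℝ → Set
x # y = x <ʳ y ⊎ y <ʳ x

open +-*-Solver using (solve; _:+_; _:*_; _:-_; :-_; con; _:=_)

ε/2+ε/2 : ∀ ε → ½ ℚ.* ε ℚ.+ ½ ℚ.* ε ≡ ε
ε/2+ε/2 = solve 1 (λ e → con ½ :* e :+ con ½ :* e := e) refl

*-pos : ∀ {p q} → 0ℚ ℚ.< p → 0ℚ ℚ.< q → 0ℚ ℚ.< p ℚ.* q
*-pos {p} {q} 0<p 0<q = ℚ.positive⁻¹ (p ℚ.* q)
  {{ℚ.pos*pos⇒pos p {{ℚ.positive 0<p}} q {{ℚ.positive 0<q}}}}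

0<½ : 0ℚ ℚ.< ½
0<½ = ℚ.positive⁻¹ ½

*-mono : ∀ {a b c d} → 0ℚ ℚ.≤ a → 0ℚ ℚ.≤ d → a ℚ.≤ b → c ℚ.≤ d →
         a ℚ.* c ℚ.≤ b ℚ.* d
*-mono {a} {b} {c} {d} 0≤a 0≤d a≤b c≤d = ℚ.≤-trans
  (ℚ.*-monoˡ-≤-nonNeg a {{ℚ.nonNegative 0≤a}} c≤d)
  (ℚ.*-monoʳ-≤-nonNeg d {{ℚ.nonNegative 0≤d}} a≤b)

p-p : ∀ p → p ℚ.- p ≡ 0ℚ
p-p = ℚ.+-inverseʳ

inv : ℚ → ℚ
inv p with p ℚ.≟ 0ℚ
... | yes _   = 0ℚ
... | no  p≢0 = ℚ.1/_ p {{ℚ.≢-nonZero p≢0}}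

inv-inverse : ∀ p → p ≢ 0ℚ → p ℚ.* inv p ≡ 1ℚ
inv-inverse p p≢0 with p ℚ.≟ 0ℚ
... | yes p≡0  = contradiction p≡0 p≢0
... | no  p≢0′ = ℚ.*-inverseʳ p {{ℚ.≢-nonZero p≢0′}}

fromℚ : ℚ → ℝ
seq    (fromℚ p) _ = p
cauchy (fromℚ p) ε 0<ε = 0 , λ _ _ _ _ →
  subst (λ d → ℚ.∣ d ∣ ℚ.≤ ε) (sym (p-p p)) (ℚ.<⇒≤ 0<ε)

fromℤ : ℤ → ℝ
fromℤ i = fromℚ (i ℚ./ 1)

fromℕ : ℕ → ℝ
fromℕ n = fromℤ (+ n)

0ʳ : ℝ
0ʳ = fromℚ 0ℚ

bounded : (x : ℝ) → ∃ λ B → 0ℚ ℚ.< B × ∃ λ N → ∀ m → N ℕ.≤ m →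
          ℚ.∣ seq x m ∣ ℚ.≤ B
bounded x with cauchy x 1ℚ (ℚ.positive⁻¹ 1ℚ)
... | N , close = B , 0<B , N , λ m N≤m → begin
  ℚ.∣ seq x m ∣                                ≡⟨ cong ℚ.∣_∣ (split (seq x m) (seq x N)) ⟩
  ℚ.∣ seq x N ℚ.+ (seq x m ℚ.- seq x N) ∣      ≤⟨ ℚ.∣p+q∣≤∣p∣+∣q∣ (seq x N) _ ⟩
  ℚ.∣ seq x N ∣ ℚ.+ ℚ.∣ seq x m ℚ.- seq x N ∣  ≤⟨ ℚ.+-monoʳ-≤ ℚ.∣ seq x N ∣ (close m N N≤m ℕ.≤-refl) ⟩
  B                                            ∎
  where
  open ℚ.≤-Reasoning
  B = ℚ.∣ seq x N ∣ ℚ.+ 1ℚ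
  0<B = ℚ.+-mono-≤-< (ℚ.0≤∣p∣ (seq x N)) (ℚ.positive⁻¹ 1ℚ)
  split : ∀ a b → a ≡ b ℚ.+ (a ℚ.- b)
  split = solve 2 (λ a b → a := b :+ (a :- b)) refl

apart : (x : ℝ) → x # 0ʳ →
        ∃ λ δ → 0ℚ ℚ.< δ × ∃ λ N → ∀ m → N ℕ.≤ m → δ ℚ.≤ ℚ.∣ seq x m ∣
apart x (inj₂ (δ , 0<δ , N , gap)) = δ , 0<δ , N , λ m N≤m →
  let δ≤x = subst (ℚ._≤ seq x m)
              (ℚ.+-identityˡ δ) (gap m N≤m)
  in subst (δ ℚ.≤_) (sym (ℚ.0≤p⇒∣p∣≡p (ℚ.≤-trans (ℚ.<⇒≤ 0<δ) δ≤x))) δ≤x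
apart x (inj₁ (δ , 0<δ , N , gap)) = δ , 0<δ , N , λ m N≤m →
  let a = seq x m
      δ≤-a  = subst₂ ℚ._≤_ (lem₁ a δ) (lem₂ a) (ℚ.+-monoʳ-≤ (ℚ.- a) (gap m N≤m))
  in subst (δ ℚ.≤_)
       (trans (sym (ℚ.0≤p⇒∣p∣≡p (ℚ.≤-trans (ℚ.<⇒≤ 0<δ) δ≤-a))) (ℚ.∣-p∣≡∣p∣ a))
       δ≤-a
  where
  lem₁ : ∀ a δ → ℚ.- a ℚ.+ (a ℚ.+ δ) ≡ δ
  lem₁ = solve 2 (λ a d → (:- a) :+ (a :+ d) := d) refl
  lem₂ : ∀ a → ℚ.- a ℚ.+ 0ℚ ≡ ℚ.- a
  lem₂ a = ℚ.+-identityʳ (ℚ.- a)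

shrink : ∀ C e → 0ℚ ℚ.< C → 0ℚ ℚ.< e → ∃ λ δ → 0ℚ ℚ.< δ × C ℚ.* δ ≡ e
shrink C e 0<C 0<e = e ℚ.* 1/C , *-pos 0<e 0<1/C , eq
  where
  open ≡-Reasoning
  1/C = (ℚ.1/ C) {{ℚ.>-nonZero 0<C}}
  0<1/C : 0ℚ ℚ.< 1/C
  0<1/C = ℚ.positive⁻¹ 1/C {{ℚ.1/pos⇒pos C {{ℚ.positive 0<C}}}}
  swap : ∀ C e i → C ℚ.* (e ℚ.* i) ≡ e ℚ.* (C ℚ.* i)
  swap = solve 3 (λ C e i → C :* (e :* i) := e :* (C :* i)) refl
  eq : C ℚ.* (e ℚ.* 1/C) ≡ e
  eq = begin
    C ℚ.* (e ℚ.* 1/C)  ≡⟨ swap C e 1/C ⟩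
    e ℚ.* (C ℚ.* 1/C)  ≡⟨ cong (e ℚ.*_) (ℚ.*-inverseʳ C {{ℚ.>-nonZero 0<C}}) ⟩
    e ℚ.* 1ℚ           ≡⟨ ℚ.*-identityʳ e ⟩
    e                  ∎

*-small : ∀ C δ e a b → C ℚ.* δ ≡ e → ℚ.∣ a ∣ ℚ.≤ C → ℚ.∣ b ∣ ℚ.≤ δ →
          ℚ.∣ a ℚ.* b ∣ ℚ.≤ e
*-small C δ e a b Cδ≡e a≤C b≤δ = begin
  ℚ.∣ a ℚ.* b ∣        ≡⟨ ℚ.∣p*q∣≡∣p∣*∣q∣ a b ⟩
  ℚ.∣ a ∣ ℚ.* ℚ.∣ b ∣  ≤⟨ *-mono (ℚ.0≤∣p∣ a) (ℚ.≤-trans (ℚ.0≤∣p∣ b) b≤δ) a≤C b≤δ ⟩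
  C ℚ.* δ              ≡⟨ Cδ≡e ⟩
  e                    ∎
  where open ℚ.≤-Reasoning

*-close : ∀ A B δ η ε a b c d → A ℚ.* δ ≡ ½ ℚ.* ε → B ℚ.* η ≡ ½ ℚ.* ε →
          ℚ.∣ a ∣ ℚ.≤ A → ℚ.∣ b ℚ.- d ∣ ℚ.≤ δ → ℚ.∣ d ∣ ℚ.≤ B → ℚ.∣ a ℚ.- c ∣ ℚ.≤ η →
          ℚ.∣ a ℚ.* b ℚ.- c ℚ.* d ∣ ℚ.≤ ε
*-close A B δ η ε a b c d Aδ Bη a≤A bd≤δ d≤B ac≤η = begin
  ℚ.∣ a ℚ.* b ℚ.- c ℚ.* d ∣
    ≡⟨ cong ℚ.∣_∣ (split a b c d) ⟩
  ℚ.∣ a ℚ.* (b ℚ.- d) ℚ.+ d ℚ.* (a ℚ.- c) ∣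
    ≤⟨ ℚ.∣p+q∣≤∣p∣+∣q∣ (a ℚ.* (b ℚ.- d)) (d ℚ.* (a ℚ.- c)) ⟩
  ℚ.∣ a ℚ.* (b ℚ.- d) ∣ ℚ.+ ℚ.∣ d ℚ.* (a ℚ.- c) ∣
    ≤⟨ ℚ.+-mono-≤ (*-small A δ (½ ℚ.* ε) a (b ℚ.- d) Aδ a≤A bd≤δ)
                  (*-small B η (½ ℚ.* ε) d (a ℚ.- c) Bη d≤B ac≤η) ⟩
  ½ ℚ.* ε ℚ.+ ½ ℚ.* ε
    ≡⟨ ε/2+ε/2 ε ⟩
  ε ∎
  where
  open ℚ.≤-Reasoning
  split : ∀ a b c d → a ℚ.* b ℚ.- c ℚ.* d ≡ a ℚ.* (b ℚ.- d) ℚ.+ d ℚ.* (a ℚ.- c)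
  split = solve 4 (λ a b c d → a :* b :- c :* d := a :* (b :- d) :+ d :* (a :- c)) refl

⊔⁴-≤ : ∀ K L M N {m} → K ℕ.⊔ L ℕ.⊔ (M ℕ.⊔ N) ℕ.≤ m →
       K ℕ.≤ m × L ℕ.≤ m × M ℕ.≤ m × N ℕ.≤ m
⊔⁴-≤ K L M N p =
  ℕ.m⊔n≤o⇒m≤o K L KL≤ , ℕ.m⊔n≤o⇒n≤o K L KL≤ ,
  ℕ.m⊔n≤o⇒m≤o M N MN≤ , ℕ.m⊔n≤o⇒n≤o M N MN≤
  where
  KL≤ = ℕ.m⊔n≤o⇒m≤o (K ℕ.⊔ L) (M ℕ.⊔ N) p
  MN≤ = ℕ.m⊔n≤o⇒n≤o (K ℕ.⊔ L) (M ℕ.⊔ N) p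

*-cauchy : (x y : ℝ) → IsCauchy (λ m → seq x m ℚ.* seq y m)
*-cauchy x y ε 0<ε =
  let A , 0<A , K , x≤A = bounded x
      B , 0<B , L , y≤B = bounded y
      0<ε/2             = *-pos 0<½ 0<ε
      δ , 0<δ , Aδ      = shrink A (½ ℚ.* ε) 0<A 0<ε/2
      η , 0<η , Bη      = shrink B (½ ℚ.* ε) 0<B 0<ε/2
      M , closeʸ        = cauchy y δ 0<δ
      N , closeˣ        = cauchy x η 0<η
  in K ℕ.⊔ L ℕ.⊔ (M ℕ.⊔ N) , λ m n p q →
    let K≤m , _   , M≤m , N≤m = ⊔⁴-≤ K L M N p
        _   , L≤n , M≤n , N≤n = ⊔⁴-≤ K L M N q
    in *-close A B δ η ε (seq x m) (seq y m) (seq x n) (seq y n) Aδ Bη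
         (x≤A m K≤m) (closeʸ m n M≤m M≤n) (y≤B n L≤n) (closeˣ m n N≤m N≤n)

0≤1 : 0ℚ ℚ.≤ 1ℚ
0≤1 = ℚ.<⇒≤ (ℚ.positive⁻¹ 1ℚ)

apart⇒≢0 : ∀ {δ a} → 0ℚ ℚ.< δ → δ ℚ.≤ ℚ.∣ a ∣ → a ≢ 0ℚ
apart⇒≢0 0<δ δ≤a refl = ℚ.<-irrefl refl (ℚ.<-≤-trans 0<δ δ≤a)

δ*inv≤1 : ∀ δ a → 0ℚ ℚ.< δ → δ ℚ.≤ ℚ.∣ a ∣ → δ ℚ.* ℚ.∣ inv a ∣ ℚ.≤ 1ℚ
δ*inv≤1 δ a 0<δ δ≤a = begin
  δ ℚ.* ℚ.∣ inv a ∣        ≤⟨ ℚ.*-monoʳ-≤-nonNeg ℚ.∣ inv a ∣ {{ℚ.nonNegative (ℚ.0≤∣p∣ (inv a))}} δ≤a ⟩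
  ℚ.∣ a ∣ ℚ.* ℚ.∣ inv a ∣  ≡⟨ ℚ.∣p*q∣≡∣p∣*∣q∣ a (inv a) ⟨
  ℚ.∣ a ℚ.* inv a ∣        ≡⟨ cong ℚ.∣_∣ (inv-inverse a (apart⇒≢0 0<δ δ≤a)) ⟩
  1ℚ                       ∎
  where open ℚ.≤-Reasoning

inv-diff : ∀ a b → a ≢ 0ℚ → b ≢ 0ℚ →
           inv a ℚ.- inv b ≡ (b ℚ.- a) ℚ.* (inv a ℚ.* inv b)
inv-diff a b a≢0 b≢0 = begin
  inv a ℚ.- inv b
    ≡⟨ cong₂ ℚ._-_ (ℚ.*-identityˡ (inv a)) (ℚ.*-identityˡ (inv b)) ⟨
  1ℚ ℚ.* inv a ℚ.- 1ℚ ℚ.* inv b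
    ≡⟨ cong₂ (λ s t → s ℚ.* inv a ℚ.- t ℚ.* inv b) (inv-inverse b b≢0) (inv-inverse a a≢0) ⟨
  (b ℚ.* inv b) ℚ.* inv a ℚ.- (a ℚ.* inv a) ℚ.* inv b
    ≡⟨ regroup a b (inv a) (inv b) ⟩
  (b ℚ.- a) ℚ.* (inv a ℚ.* inv b) ∎
  where
  open ≡-Reasoning
  regroup : ∀ a b i j → (b ℚ.* j) ℚ.* i ℚ.- (a ℚ.* i) ℚ.* j ≡ (b ℚ.- a) ℚ.* (i ℚ.* j)
  regroup = solve 4 (λ a b i j → (b :* j) :* i :- (a :* i) :* j := (b :- a) :* (i :* j)) refl

inv-close : ∀ δ ε a b → 0ℚ ℚ.< δ → δ ℚ.≤ ℚ.∣ a ∣ → δ ℚ.≤ ℚ.∣ b ∣ →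
            ℚ.∣ b ℚ.- a ∣ ℚ.≤ ε ℚ.* (δ ℚ.* δ) → ℚ.∣ inv a ℚ.- inv b ∣ ℚ.≤ ε
inv-close δ ε a b 0<δ δ≤a δ≤b close =
  ℚ.*-cancelʳ-≤-pos (δ ℚ.* δ) {{ℚ.positive (*-pos 0<δ 0<δ)}} (begin
    ℚ.∣ inv a ℚ.- inv b ∣ ℚ.* (δ ℚ.* δ)
      ≡⟨ cong (λ t → ℚ.∣ t ∣ ℚ.* (δ ℚ.* δ)) (inv-diff a b (apart⇒≢0 0<δ δ≤a) (apart⇒≢0 0<δ δ≤b)) ⟩
    ℚ.∣ (b ℚ.- a) ℚ.* (inv a ℚ.* inv b) ∣ ℚ.* (δ ℚ.* δ)
      ≡⟨ cong (ℚ._* (δ ℚ.* δ)) (trans (ℚ.∣p*q∣≡∣p∣*∣q∣ (b ℚ.- a) (inv a ℚ.* inv b))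
           (cong (ℚ.∣ b ℚ.- a ∣ ℚ.*_) (ℚ.∣p*q∣≡∣p∣*∣q∣ (inv a) (inv b)))) ⟩
    (ℚ.∣ b ℚ.- a ∣ ℚ.* (ℚ.∣ inv a ∣ ℚ.* ℚ.∣ inv b ∣)) ℚ.* (δ ℚ.* δ)
      ≡⟨ shuffle ℚ.∣ b ℚ.- a ∣ ℚ.∣ inv a ∣ ℚ.∣ inv b ∣ δ ⟩
    ℚ.∣ b ℚ.- a ∣ ℚ.* ((δ ℚ.* ℚ.∣ inv a ∣) ℚ.* (δ ℚ.* ℚ.∣ inv b ∣))
      ≤⟨ *-mono (ℚ.0≤∣p∣ (b ℚ.- a)) 0≤1 ℚ.≤-refl
           (*-mono (0≤δ* a) 0≤1 (δ*inv≤1 δ a 0<δ δ≤a) (δ*inv≤1 δ b 0<δ δ≤b)) ⟩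
    ℚ.∣ b ℚ.- a ∣ ℚ.* 1ℚ
      ≡⟨ ℚ.*-identityʳ ℚ.∣ b ℚ.- a ∣ ⟩
    ℚ.∣ b ℚ.- a ∣
      ≤⟨ close ⟩
    ε ℚ.* (δ ℚ.* δ) ∎)
  where
  open ℚ.≤-Reasoning
  shuffle : ∀ d i j δ → (d ℚ.* (i ℚ.* j)) ℚ.* (δ ℚ.* δ) ≡ d ℚ.* ((δ ℚ.* i) ℚ.* (δ ℚ.* j))
  shuffle = solve 4 (λ d i j e → (d :* (i :* j)) :* (e :* e) := d :* ((e :* i) :* (e :* j))) refl
  0≤δ* : ∀ a → 0ℚ ℚ.≤ δ ℚ.* ℚ.∣ inv a ∣
  0≤δ* a = subst (ℚ._≤ δ ℚ.* ℚ.∣ inv a ∣) (ℚ.*-zeroʳ δ)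
    (ℚ.*-monoˡ-≤-nonNeg δ {{ℚ.nonNegative (ℚ.<⇒≤ 0<δ)}} (ℚ.0≤∣p∣ (inv a)))

inv-cauchy : (x : ℝ) → x # 0ʳ → IsCauchy (λ m → inv (seq x m))
inv-cauchy x x#0 ε 0<ε =
  let δ , 0<δ , M , δ≤x = apart x x#0
      N , close         = cauchy x (ε ℚ.* (δ ℚ.* δ)) (*-pos 0<ε (*-pos 0<δ 0<δ))
  in M ℕ.⊔ N , λ m n p q →
    inv-close δ ε (seq x m) (seq x n) 0<δ
      (δ≤x m (ℕ.m⊔n≤o⇒m≤o M N p)) (δ≤x n (ℕ.m⊔n≤o⇒m≤o M N q))
      (close n m (ℕ.m⊔n≤o⇒n≤o M N q) (ℕ.m⊔n≤o⇒n≤o M N p))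

infix  8 -ʳ_
infixl 6 _+ʳ_ _-ʳ_
infixl 7 _*ʳ_ _÷ʳ_[_]

_+ʳ_ : ℝ → ℝ → ℝ
seq    (x +ʳ y) m = seq x m ℚ.+ seq y m
cauchy (x +ʳ y) ε 0<ε
  with cauchy x (½ ℚ.* ε) (*-pos 0<½ 0<ε) | cauchy y (½ ℚ.* ε) (*-pos 0<½ 0<ε)
... | M , closeˣ | N , closeʸ = M ℕ.⊔ N , λ m n p q → begin
    ℚ.∣ (seq x m ℚ.+ seq y m) ℚ.- (seq x n ℚ.+ seq y n) ∣
      ≡⟨ cong ℚ.∣_∣ (split (seq x m) (seq y m) (seq x n) (seq y n)) ⟩
    ℚ.∣ (seq x m ℚ.- seq x n) ℚ.+ (seq y m ℚ.- seq y n) ∣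
      ≤⟨ ℚ.∣p+q∣≤∣p∣+∣q∣ (seq x m ℚ.- seq x n) (seq y m ℚ.- seq y n) ⟩
    ℚ.∣ seq x m ℚ.- seq x n ∣ ℚ.+ ℚ.∣ seq y m ℚ.- seq y n ∣
      ≤⟨ ℚ.+-mono-≤ (closeˣ m n (ℕ.m⊔n≤o⇒m≤o M N p) (ℕ.m⊔n≤o⇒m≤o M N q))
                    (closeʸ m n (ℕ.m⊔n≤o⇒n≤o M N p) (ℕ.m⊔n≤o⇒n≤o M N q)) ⟩
    ½ ℚ.* ε ℚ.+ ½ ℚ.* ε
      ≡⟨ ε/2+ε/2 ε ⟩
    ε ∎
    where
    open ℚ.≤-Reasoning
    split : ∀ a b c d → (a ℚ.+ b) ℚ.- (c ℚ.+ d) ≡ (a ℚ.- c) ℚ.+ (b ℚ.- d)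
    split = solve 4 (λ a b c d → (a :+ b) :- (c :+ d) := (a :- c) :+ (b :- d)) refl

-ʳ_ : ℝ → ℝ
seq    (-ʳ x) m = ℚ.- seq x m
cauchy (-ʳ x) ε 0<ε with cauchy x ε 0<ε
... | N , close = N , λ m n p q →
    subst (ℚ._≤ ε)
      (trans (sym (ℚ.∣-p∣≡∣p∣ (seq x m ℚ.- seq x n)))
             (cong ℚ.∣_∣ (ℚ.neg-distrib-+ (seq x m) (ℚ.- seq x n))))
      (close m n p q)

_-ʳ_ : ℝ → ℝ → ℝ
x -ʳ y = x +ʳ (-ʳ y)

_*ʳ_ : ℝ → ℝ → ℝ
seq    (x *ʳ y) m = seq x m ℚ.* seq y m
cauchy (x *ʳ y) = *-cauchy x y

-- Only finitely many terms of an x # 0ʳ can vanish; `inv` sends those to 0ℚ.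
recip : (x : ℝ) → x # 0ʳ → ℝ
seq    (recip x _)   m = inv (seq x m)
cauchy (recip x x#0) = inv-cauchy x x#0

_÷ʳ_[_] : (x y : ℝ) → y # 0ʳ → ℝ
x ÷ʳ y [ y#0 ] = x *ʳ recip y y#0

isqrt : ℕ → ℕ
isqrt zero    = 0
isqrt (suc n) with suc (isqrt n) ℕ.* suc (isqrt n) ℕ.≤? suc n
... | yes _ = suc (isqrt n)
... | no  _ = isqrt n

isqrt-lower : ∀ n → isqrt n ℕ.* isqrt n ℕ.≤ n
isqrt-lower zero    = z≤n
isqrt-lower (suc n) with suc (isqrt n) ℕ.* suc (isqrt n) ℕ.≤? suc n
... | yes r²≤n = r²≤n
... | no  _    = ℕ.m≤n⇒m≤1+n (isqrt-lower n)

isqrt-upper : ∀ n → n ℕ.< suc (isqrt n) ℕ.* suc (isqrt n)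
isqrt-upper zero    = s≤s z≤n
isqrt-upper (suc n) with suc (isqrt n) ℕ.* suc (isqrt n) ℕ.≤? suc n
... | no  r²≰n = ℕ.≰⇒> r²≰n
... | yes _    = ℕ.≤-trans (s≤s (isqrt-upper n)) (ℕ.*-mono-< (ℕ.n<1+n (suc (isqrt n))) (ℕ.n<1+n (suc (isqrt n))))

-- √-approx d m = ⌊ M √d ⌋ / M with M = suc m.
√-approx : ℕ → ℕ → ℚ
√-approx d m = (+ isqrt (d ℕ.* (suc m ℕ.* suc m))) ℚ./ suc m

square-cancel-< : ∀ a b → a ℕ.* a ℕ.< b ℕ.* b → a ℕ.< b
square-cancel-< a b a²<b² = ℕ.≰⇒> λ b≤a → ℕ.<⇒≱ a²<b² (ℕ.*-mono-≤ b≤a b≤a)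

square-cancel-≤ : ∀ a b → a ℕ.* a ℕ.≤ b ℕ.* b → a ℕ.≤ b
square-cancel-≤ a b a²≤b² = ℕ.≮⇒≥ λ b<a → ℕ.<⇒≱ (ℕ.*-mono-< b<a b<a) a²≤b²

cross : ∀ d L M a b → a ℕ.* a ℕ.≤ d ℕ.* (M ℕ.* M) → d ℕ.* (L ℕ.* L) ℕ.< b ℕ.* b →
        .{{ℕ.NonZero M}} → a ℕ.* L ℕ.< b ℕ.* M
cross d L M a b p q = square-cancel-< (a ℕ.* L) (b ℕ.* M) (begin-strict
  (a ℕ.* L) ℕ.* (a ℕ.* L)       ≡⟨ lem₁ a L ⟩
  (a ℕ.* a) ℕ.* (L ℕ.* L)       ≤⟨ ℕ.*-monoˡ-≤ (L ℕ.* L) p ⟩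
  d ℕ.* (M ℕ.* M) ℕ.* (L ℕ.* L) ≡⟨ lem₂ d L M ⟩
  d ℕ.* (L ℕ.* L) ℕ.* (M ℕ.* M) <⟨ ℕ.*-monoˡ-< (M ℕ.* M) {{ℕ.m*n≢0 M M}} q ⟩
  b ℕ.* b ℕ.* (M ℕ.* M)         ≡⟨ lem₁ b M ⟨
  (b ℕ.* M) ℕ.* (b ℕ.* M)       ∎)
  where
  open ℕ.≤-Reasoning
  lem₁ : ∀ a L → (a ℕ.* L) ℕ.* (a ℕ.* L) ≡ (a ℕ.* a) ℕ.* (L ℕ.* L)
  lem₁ = solve-∀
  lem₂ : ∀ d L M → d ℕ.* (M ℕ.* M) ℕ.* (L ℕ.* L) ≡ d ℕ.* (L ℕ.* L) ℕ.* (M ℕ.* M)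
  lem₂ = solve-∀

/-≤ : ∀ a b m l → a ℕ.* suc l ℕ.≤ b ℕ.* suc m → (+ a) ℚ./ suc m ℚ.≤ (+ b) ℚ./ suc l
/-≤ a b m l p = ℚ.toℚᵘ-cancel-≤ (begin
  ℚ.toℚᵘ ((+ a) ℚ./ suc m)  ≃⟨ ℚ.toℚᵘ-fromℚᵘ (mkℚᵘ (+ a) m) ⟩
  mkℚᵘ (+ a) m              ≤⟨ ℚᵘ.*≤* (subst₂ ℤ._≤_ (ℤ.pos-* a (suc l)) (ℤ.pos-* b (suc m)) (ℤ.+≤+ p)) ⟩
  mkℚᵘ (+ b) l              ≃⟨ ℚ.toℚᵘ-fromℚᵘ (mkℚᵘ (+ b) l) ⟨
  ℚ.toℚᵘ ((+ b) ℚ./ suc l)  ∎)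
  where open ℚᵘ.≤-Reasoning

/-suc : ∀ b l → (+ suc b) ℚ./ suc l ≡ (+ b) ℚ./ suc l ℚ.+ (+ 1) ℚ./ suc l
/-suc b l = ℚ.toℚᵘ-injective (begin
  ℚ.toℚᵘ ((+ suc b) ℚ./ suc l)
    ≈⟨ ℚ.toℚᵘ-fromℚᵘ (mkℚᵘ (+ suc b) l) ⟩
  mkℚᵘ (+ suc b) l
    ≈⟨ ℚᵘ.*≡* (trans (sym (ℤ.pos-* (suc b) (suc l ℕ.* suc l))) (trans (cong +_ (lem b (suc l)))
         (trans (ℤ.pos-* (b ℕ.* suc l ℕ.+ 1 ℕ.* suc l) (suc l))
           (cong (ℤ._* (+ suc l)) (trans (ℤ.pos-+ (b ℕ.* suc l) (1 ℕ.* suc l)) (cong₂ ℤ._+_ (ℤ.pos-* b (suc l)) (ℤ.pos-* 1 (suc l)))))))) ⟩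
  mkℚᵘ (+ b) l ℚᵘ.+ mkℚᵘ (+ 1) l
    ≈⟨ ℚᵘ.+-cong (ℚ.toℚᵘ-fromℚᵘ (mkℚᵘ (+ b) l)) (ℚ.toℚᵘ-fromℚᵘ (mkℚᵘ (+ 1) l)) ⟨
  ℚ.toℚᵘ ((+ b) ℚ./ suc l) ℚᵘ.+ ℚ.toℚᵘ ((+ 1) ℚ./ suc l)
    ≈⟨ ℚ.toℚᵘ-homo-+ ((+ b) ℚ./ suc l) ((+ 1) ℚ./ suc l) ⟨
  ℚ.toℚᵘ ((+ b) ℚ./ suc l ℚ.+ (+ 1) ℚ./ suc l) ∎)
  where
  open ℚᵘ.≃-Reasoning
  lem : ∀ b L → suc b ℕ.* (L ℕ.* L) ≡ (b ℕ.* L ℕ.+ 1 ℕ.* L) ℕ.* L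
  lem = solve-∀

1/suc≤ : ∀ ε → 0ℚ ℚ.< ε → ∃ λ N → ∀ n → N ℕ.≤ n → (+ 1) ℚ./ suc n ℚ.≤ ε
1/suc≤ ε 0<ε = positive-case ε (ℚ.positive 0<ε)
  where
  positive-case : ∀ ε → ℚ.Positive ε → ∃ λ N → ∀ n → N ℕ.≤ n → (+ 1) ℚ./ suc n ℚ.≤ ε
  positive-case ε@(ℚ.mkℚ (+ suc a) d _) _ = d , λ n d≤n → subst ((+ 1) ℚ./ suc n ℚ.≤_)
    (ℚ.fromℚᵘ-toℚᵘ ε) (/-≤ 1 (suc a) n d (ℕ.*-mono-≤ {1} {suc a} (s≤s z≤n) (s≤s d≤n)))

∣-∣-≤ : ∀ p q ε → p ℚ.≤ q ℚ.+ ε → q ℚ.≤ p ℚ.+ ε → ℚ.∣ p ℚ.- q ∣ ℚ.≤ ε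
∣-∣-≤ p q ε p≤ q≤ with ℚ.∣p∣≡p∨∣p∣≡-p (p ℚ.- q)
... | inj₁ eq = subst₂ ℚ._≤_ (sym eq) (lem q ε) (ℚ.+-monoˡ-≤ (ℚ.- q) p≤)
  where
  lem : ∀ q ε → q ℚ.+ ε ℚ.+ (ℚ.- q) ≡ ε
  lem = solve 2 (λ q e → q :+ e :+ (:- q) := e) refl
... | inj₂ eq = subst₂ ℚ._≤_ (trans (lem₁ p q) (sym eq)) (lem₂ p ε) (ℚ.+-monoˡ-≤ (ℚ.- p) q≤)
  where
  lem₁ : ∀ p q → q ℚ.+ (ℚ.- p) ≡ ℚ.- (p ℚ.- q)
  lem₁ = solve 2 (λ p q → q :+ (:- p) := :- (p :- q)) refl
  lem₂ : ∀ p ε → p ℚ.+ ε ℚ.+ (ℚ.- p) ≡ ε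
  lem₂ = solve 2 (λ p e → p :+ e :+ (:- p) := e) refl

√-approx-close : ∀ d m l → √-approx d m ℚ.≤ √-approx d l ℚ.+ (+ 1) ℚ./ suc l
√-approx-close d m l = subst (√-approx d m ℚ.≤_) (/-suc b l) (/-≤ a (suc b) m l (ℕ.<⇒≤
  (cross d (suc l) (suc m) a (suc b) (isqrt-lower (d ℕ.* (suc m ℕ.* suc m)))
                                     (isqrt-upper (d ℕ.* (suc l ℕ.* suc l))))))
  where
  a = isqrt (d ℕ.* (suc m ℕ.* suc m))
  b = isqrt (d ℕ.* (suc l ℕ.* suc l))

√-cauchy : ∀ d → IsCauchy (√-approx d)
√-cauchy d ε 0<ε =
  let N , small = 1/suc≤ ε 0<ε
  in N , λ m n N≤m N≤n → ∣-∣-≤ (√-approx d m) (√-approx d n) ε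
       (ℚ.≤-trans (√-approx-close d m n) (ℚ.+-monoʳ-≤ (√-approx d n) (small n N≤n)))
       (ℚ.≤-trans (√-approx-close d n m) (ℚ.+-monoʳ-≤ (√-approx d m) (small m N≤m)))

infix 9 √_

√_ : ℕ → ℝ
seq    (√ d) = √-approx d
cauchy (√ d) = √-cauchy d

√-upper : ∀ d c → d ℕ.≤ c ℕ.* c → ∀ m → seq (√ d) m ℚ.≤ (+ c) ℚ./ 1
√-upper d c d≤c² m = /-≤ r c m 0 (subst (ℕ._≤ c ℕ.* suc m) (sym (ℕ.*-identityʳ r))
  (square-cancel-≤ r (c ℕ.* suc m) (begin
    r ℕ.* r                               ≤⟨ isqrt-lower (d ℕ.* (suc m ℕ.* suc m)) ⟩
    d ℕ.* (suc m ℕ.* suc m)               ≤⟨ ℕ.*-monoˡ-≤ (suc m ℕ.* suc m) d≤c² ⟩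
    c ℕ.* c ℕ.* (suc m ℕ.* suc m)         ≡⟨ lem c (suc m) ⟩
    (c ℕ.* suc m) ℕ.* (c ℕ.* suc m)       ∎)))
  where
  open ℕ.≤-Reasoning
  r = isqrt (d ℕ.* (suc m ℕ.* suc m))
  lem : ∀ c M → c ℕ.* c ℕ.* (M ℕ.* M) ≡ (c ℕ.* M) ℕ.* (c ℕ.* M)
  lem = solve-∀

IsFloor : ℝ → ℤ → Set
IsFloor x z = fromℤ z ≤ʳ x × x <ʳ fromℤ (z ℤ.+ (+ 1))

fromℕ#0 : ∀ n → .{{ℕ.NonZero n}} → fromℕ n # 0ʳ
fromℕ#0 (suc n) = inj₂ (1ℚ , ℚ.positive⁻¹ 1ℚ , 0 , λ _ _ →
  /-≤ 1 (suc n) 0 0 (s≤s z≤n))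

-- The subtraction of naturals under the root is exact for 1 ≤ k.
denominator : ℕ → ℝ
denominator k =
  fromℕ (48 ℕ.* k ^ 3) +ʳ fromℕ (84 ℕ.* k ^ 2) -ʳ fromℕ (72 ℕ.* k)
    -ʳ (fromℕ (16 ℕ.* k ^ 2) -ʳ fromℕ 13) *ʳ √ (8 ℕ.* k ∸ 7)
    +ʳ fromℕ 36

ι : ℕ → ℚ
ι n = (+ n) ℚ./ 1

ι-mono : ∀ {m n} → m ℕ.≤ n → ι m ℚ.≤ ι n
ι-mono {m} {n} m≤n = /-≤ m n 0 0 (ℕ.*-monoˡ-≤ 1 m≤n)

ι-+ : ∀ m n → ι (m ℕ.+ n) ≡ ι m ℚ.+ ι n
ι-+ zero    n = sym (ℚ.+-identityˡ (ι n))
ι-+ (suc m) n = begin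
  ι (suc m ℕ.+ n)          ≡⟨ /-suc (m ℕ.+ n) 0 ⟩
  ι (m ℕ.+ n) ℚ.+ 1ℚ       ≡⟨ cong (ℚ._+ 1ℚ) (ι-+ m n) ⟩
  ι m ℚ.+ ι n ℚ.+ 1ℚ       ≡⟨ lem (ι m) (ι n) ⟩
  ι m ℚ.+ 1ℚ ℚ.+ ι n       ≡⟨ cong (ℚ._+ ι n) (/-suc m 0) ⟨
  ι (suc m) ℚ.+ ι n        ∎
  where
  open ≡-Reasoning
  lem : ∀ a b → a ℚ.+ b ℚ.+ 1ℚ ≡ a ℚ.+ 1ℚ ℚ.+ b
  lem = solve 2 (λ a b → a :+ b :+ con 1ℚ := a :+ con 1ℚ :+ b) refl

ι-* : ∀ m n → ι (m ℕ.* n) ≡ ι m ℚ.* ι n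
ι-* zero    n = sym (ℚ.*-zeroˡ (ι n))
ι-* (suc m) n = begin
  ι (n ℕ.+ m ℕ.* n)        ≡⟨ ι-+ n (m ℕ.* n) ⟩
  ι n ℚ.+ ι (m ℕ.* n)      ≡⟨ cong (ι n ℚ.+_) (ι-* m n) ⟩
  ι n ℚ.+ ι m ℚ.* ι n      ≡⟨ lem (ι m) (ι n) ⟩
  (ι m ℚ.+ 1ℚ) ℚ.* ι n     ≡⟨ cong (ℚ._* ι n) (/-suc m 0) ⟨
  ι (suc m) ℚ.* ι n        ∎
  where
  open ≡-Reasoning
  lem : ∀ a b → b ℚ.+ a ℚ.* b ≡ (a ℚ.+ 1ℚ) ℚ.* b
  lem = solve 2 (λ a b → b :+ a :* b := (a :+ con 1ℚ) :* b) refl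

p≤q⇒0≤q-p : ∀ {p q} → p ℚ.≤ q → 0ℚ ℚ.≤ q ℚ.- p
p≤q⇒0≤q-p {p} {q} p≤q = subst (ℚ._≤ q ℚ.- p) (p-p p) (ℚ.+-monoˡ-≤ (ℚ.- p) p≤q)

-- Termwise positivity of `denominator k`; s stands for a term of the square
-- root and u for the upper bound 2k.
1≤denominator : ∀ A B C D E F s u → E ℚ.≤ D → s ℚ.≤ u →
  1ℚ ℚ.+ C ℚ.+ D ℚ.* u ℚ.≤ A ℚ.+ B ℚ.+ E ℚ.* u ℚ.+ F →
  0ℚ ℚ.+ 1ℚ ℚ.≤ A ℚ.+ B ℚ.- C ℚ.- (D ℚ.- E) ℚ.* s ℚ.+ F
1≤denominator A B C D E F s u E≤D s≤u P≤Q = subst₂ ℚ._≤_ refl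
  (lem A B C D E F s u) (ℚ.+-mono-≤
    (ℚ.+-mono-≤ (p≤q⇒0≤q-p P≤Q)
      (*-nonNeg (p≤q⇒0≤q-p E≤D) (p≤q⇒0≤q-p s≤u))) ℚ.≤-refl)
  where
  *-nonNeg : ∀ {a b} → 0ℚ ℚ.≤ a → 0ℚ ℚ.≤ b → 0ℚ ℚ.≤ a ℚ.* b
  *-nonNeg {a} {b} 0≤a 0≤b = subst (ℚ._≤ a ℚ.* b) (ℚ.*-zeroʳ a)
    (ℚ.*-monoˡ-≤-nonNeg a {{ℚ.nonNegative 0≤a}} 0≤b)
  lem : ∀ A B C D E F s u →
    ((A ℚ.+ B ℚ.+ E ℚ.* u ℚ.+ F) ℚ.- (1ℚ ℚ.+ C ℚ.+ D ℚ.* u)) ℚ.+ (D ℚ.- E) ℚ.* (u ℚ.- s) ℚ.+ 1ℚ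
    ≡ A ℚ.+ B ℚ.- C ℚ.- (D ℚ.- E) ℚ.* s ℚ.+ F
  lem = solve 8 (λ A B C D E F s u →
    ((A :+ B :+ E :* u :+ F) :- (con 1ℚ :+ C :+ D :* u)) :+ (D :- E) :* (u :- s) :+ con 1ℚ
    := A :+ B :- C :- (D :- E) :* s :+ F) refl

denominator-bound : ∀ k → 2 ℕ.≤ k →
  1 ℕ.+ 72 ℕ.* k ℕ.+ 16 ℕ.* k ^ 2 ℕ.* (2 ℕ.* k)
    ℕ.≤ 48 ℕ.* k ^ 3 ℕ.+ 84 ℕ.* k ^ 2 ℕ.+ 13 ℕ.* (2 ℕ.* k) ℕ.+ 36
denominator-bound (suc (suc j)) (s≤s (s≤s _)) = ℕ.m+n≤o⇒m≤o _ (ℕ.≤-reflexive (lem j))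
  where
  lem : ∀ j →
    1 ℕ.+ 72 ℕ.* (2 ℕ.+ j) ℕ.+ 16 ℕ.* ((2 ℕ.+ j) ℕ.* ((2 ℕ.+ j) ℕ.* 1)) ℕ.* (2 ℕ.* (2 ℕ.+ j))
      ℕ.+ (16 ℕ.* (j ℕ.* (j ℕ.* (j ℕ.* 1))) ℕ.+ 180 ℕ.* (j ℕ.* (j ℕ.* 1)) ℕ.+ 482 ℕ.* j ℕ.+ 407)
    ≡ 48 ℕ.* ((2 ℕ.+ j) ℕ.* ((2 ℕ.+ j) ℕ.* ((2 ℕ.+ j) ℕ.* 1))) ℕ.+ 84 ℕ.* ((2 ℕ.+ j) ℕ.* ((2 ℕ.+ j) ℕ.* 1)) ℕ.+ 13 ℕ.* (2 ℕ.* (2 ℕ.+ j)) ℕ.+ 36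
  lem = solve-∀

8k-7≤ : ∀ k → 2 ℕ.≤ k → 8 ℕ.* k ∸ 7 ℕ.≤ 2 ℕ.* k ℕ.* (2 ℕ.* k)
8k-7≤ (suc (suc j)) (s≤s (s≤s _)) = ℕ.m≤n+o⇒m∸n≤o (8 ℕ.* (2 ℕ.+ j)) 7 (ℕ.m+n≤o⇒m≤o _ (ℕ.≤-reflexive (lem j)))
  where
  lem : ∀ j →
    8 ℕ.* (2 ℕ.+ j) ℕ.+ (4 ℕ.* (j ℕ.* j) ℕ.+ 8 ℕ.* j ℕ.+ 7) ≡ 7 ℕ.+ 2 ℕ.* (2 ℕ.+ j) ℕ.* (2 ℕ.* (2 ℕ.+ j))
  lem = solve-∀

13≤16k² : ∀ k → 2 ℕ.≤ k → 13 ℕ.≤ 16 ℕ.* k ^ 2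
13≤16k² k 2≤k = ℕ.≤-trans (ℕ.m≤m+n 13 51) (ℕ.*-monoʳ-≤ 16 (ℕ.^-monoˡ-≤ 2 2≤k))

denominator#0 : ∀ k → 2 ℕ.≤ k → denominator k # 0ʳ
denominator#0 k 2≤k = inj₂ (1ℚ , ℚ.positive⁻¹ 1ℚ , 0 , λ m _ →
  1≤denominator (ι (48 ℕ.* k ^ 3)) (ι (84 ℕ.* k ^ 2)) (ι (72 ℕ.* k)) (ι (16 ℕ.* k ^ 2))
    (ι 13) (ι 36) (√-approx (8 ℕ.* k ∸ 7) m) (ι (2 ℕ.* k))
    (ι-mono (13≤16k² k 2≤k)) (√-upper (8 ℕ.* k ∸ 7) (2 ℕ.* k) (8k-7≤ k 2≤k) m)
    (subst₂ ℚ._≤_ lhs rhs (ι-mono (denominator-bound k 2≤k))))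
  where
  lhs : ι (1 ℕ.+ 72 ℕ.* k ℕ.+ 16 ℕ.* k ^ 2 ℕ.* (2 ℕ.* k))
        ≡ 1ℚ ℚ.+ ι (72 ℕ.* k) ℚ.+ ι (16 ℕ.* k ^ 2) ℚ.* ι (2 ℕ.* k)
  lhs = trans (ι-+ (1 ℕ.+ 72 ℕ.* k) (16 ℕ.* k ^ 2 ℕ.* (2 ℕ.* k)))
    (cong₂ ℚ._+_ (ι-+ 1 (72 ℕ.* k)) (ι-* (16 ℕ.* k ^ 2) (2 ℕ.* k)))
  rhs : ι (48 ℕ.* k ^ 3 ℕ.+ 84 ℕ.* k ^ 2 ℕ.+ 13 ℕ.* (2 ℕ.* k) ℕ.+ 36)
        ≡ ι (48 ℕ.* k ^ 3) ℚ.+ ι (84 ℕ.* k ^ 2) ℚ.+ ι 13 ℚ.* ι (2 ℕ.* k) ℚ.+ ι 36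
  rhs = trans (ι-+ (48 ℕ.* k ^ 3 ℕ.+ 84 ℕ.* k ^ 2 ℕ.+ 13 ℕ.* (2 ℕ.* k)) 36)
    (cong (ℚ._+ ι 36) (trans (ι-+ (48 ℕ.* k ^ 3 ℕ.+ 84 ℕ.* k ^ 2) (13 ℕ.* (2 ℕ.* k)))
      (cong₂ ℚ._+_ (ι-+ (48 ℕ.* k ^ 3) (84 ℕ.* k ^ 2)) (ι-* 13 (2 ℕ.* k)))))

-- A k-tree is chordal, so the vertices of one degree contain an independent set
-- of size at least their number divided by the largest clique among them.  All
-- cliques have at most k + 1 vertices, and if n ≥ k + j + 2, then a clique whose
-- vertices have degree at most k + j has at most j + 1 vertices.  Hence, for
-- n > 2k and a = αreg G, at most min (j + 1) (k + 1) · a vertices have degree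
-- k + j.  The degree sum 2kn - k(k + 1) bounds the sum of 3k ∸ deg u from below
-- by kn + k(k + 1), while the bounds on the degree classes bound it from above;
-- this yields 6n < a(k + 1)(7k + 5), which is trivial for n ≤ 2k.  Finally,
-- 4√(8k-7) ≤ 5k + 2 shows that the denominator is at least 4k(k + 1)(7k + 5).

{-# OPTIONS --safe #-}
module Submission where

open import Defs
import Algebra.Properties.Semiring.Sum
open import Data.Bool.Base using (Bool; true; false; not; _∧_; _∨_)
open import Data.Bool.Properties using (∧-conicalˡ; ∧-conicalʳ)
open import Data.Fin.Base using (Fin; zero; suc; punchIn; punchOut; toℕ; fromℕ<)
open import Data.Fin.Properties as Fin
  using (punchIn-punchOut; punchIn-injective; punchInᵢ≢i; toℕ-fromℕ<; toℕ<n)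
open import Data.Fin.Subset using (Subset; _∈_; ∣_∣)
open import Data.Integer.Base as ℤ using (ℤ)
import Data.Integer.Properties as ℤ
import Data.List.Base as List
open import Data.List.Extrema.Nat using (v≤max⁺)
import Data.List.Membership.Propositional as List
open import Data.List.Membership.Propositional.Properties
  using (∈-map⁺; ∈-++⁺ˡ; ∈-++⁺ʳ; ∈-filter⁺)
open import Data.List.Relation.Unary.Any using (here)
open import Data.Nat.Base
  using (ℕ; zero; suc; _+_; _*_; _∸_; _^_; _≤_; _<_; z≤n; s≤s; s≤s⁻¹; NonZero; >-nonZero)
open import Data.Nat.Properties
open import Data.Nat.Tactic.RingSolver using (solve-∀)
open import Data.Product.Base using (∃; _×_; _,_)
open import Data.Rational.Base as ℚ using (ℚ; 0ℚ; 1ℚ)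
import Data.Rational.Properties as ℚ
open import Data.Rational.Solver using (module +-*-Solver)
open import Data.Rational.Unnormalised.Base as ℚᵘ using (mkℚᵘ)
import Data.Rational.Unnormalised.Properties as ℚᵘ
open import Data.Sum.Base using (inj₂)
open import Data.Vec.Base using ([]; _∷_; tabulate)
open import Data.Vec.Functional using (Vector; insertAt)
open import Data.Vec.Functional.Properties using (insertAt-lookup; insertAt-punchIn)
open import Data.Vec.Properties using (lookup∘tabulate; lookup⇒[]=; []=⇒lookup)
open import Function.Base using (_∘_)
open import Relation.Binary.PropositionalEquality
  using (_≡_; _≢_; refl; sym; trans; cong; cong₂; subst; subst₂; module ≡-Reasoning)
open import Relation.Nullary using (Dec; yes; no; does; contradiction)
open import Relation.Nullary.Decidable using (dec-true)

open Algebra.Properties.Semiring.Sum +-*-semiring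
open +-*-Solver using (solve; _:+_; _:*_; _:-_; _:=_)

private variable
  n : ℕ

-- Finite sums and counting of Boolean predicates.

sum-mono : {f g : Vector ℕ n} → (∀ i → f i ≤ g i) → sum f ≤ sum g
sum-mono {zero}  f≤g = z≤n
sum-mono {suc n} f≤g = +-mono-≤ (f≤g zero) (sum-mono (f≤g ∘ suc))

sum-const : ∀ n c → ∑[ i < n ] c ≡ n * c
sum-const zero    c = refl
sum-const (suc n) c = cong (c +_) (sum-const n c)

term≤sum : (f : Vector ℕ n) (i : Fin n) → f i ≤ sum f
term≤sum f zero    = m≤m+n _ _
term≤sum f (suc i) = ≤-trans (term≤sum (f ∘ suc) i) (m≤n+m _ (f zero))

𝟙 : Bool → ℕ
𝟙 true  = 1
𝟙 false = 0

𝟙≤1 : ∀ b → 𝟙 b ≤ 1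
𝟙≤1 true  = ≤-refl
𝟙≤1 false = z≤n

infix 4 _⊆ᵇ_

_⊆ᵇ_ : (P Q : Fin n → Bool) → Set
P ⊆ᵇ Q = ∀ u → P u ≡ true → Q u ≡ true

count : (Fin n → Bool) → ℕ
count P = sum (𝟙 ∘ P)

count-mono : {P Q : Fin n → Bool} → P ⊆ᵇ Q → count P ≤ count Q
count-mono {P = P} {Q} P⊆Q = sum-mono λ i → 𝟙-mono (P i) (Q i) (P⊆Q i)
  where
  𝟙-mono : ∀ a b → (a ≡ true → b ≡ true) → 𝟙 a ≤ 𝟙 b
  𝟙-mono true  b a⇒b = ≤-reflexive (cong 𝟙 (sym (a⇒b refl)))
  𝟙-mono false b a⇒b = z≤n

count≤n : (P : Fin n → Bool) → count P ≤ n
count≤n {n} P = ≤-trans (sum-mono (𝟙≤1 ∘ P)) (≤-reflexive (trans (sum-const n 1) (*-identityʳ n)))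

count-punchIn : ∀ v (P : Fin (suc n) → Bool) → count P ≡ 𝟙 (P v) + count (P ∘ punchIn v)
count-punchIn v P = sum-remove {i = v} (𝟙 ∘ P)

-- The value `b` is a parameter, so that the summand `𝟙 b` computes away once the value of `P` at
-- `v` is known.
count-at : ∀ v (P : Fin (suc n) → Bool) {b} → P v ≡ b → count P ≡ 𝟙 b + count (P ∘ punchIn v)
count-at v P refl = count-punchIn v P

count-insertAt : ∀ v (P : Fin n → Bool) b → count (insertAt P v b) ≡ 𝟙 b + count P
count-insertAt v P b = trans (count-punchIn v (insertAt P v b))
  (cong₂ _+_ (cong 𝟙 (insertAt-lookup P v b)) (sum-cong-≗ (cong 𝟙 ∘ insertAt-punchIn P v b)))

count-false : ∀ v (P : Fin (suc n) → Bool) → P v ≡ false → count P ≤ n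
count-false v P Pv≡f = subst (_≤ _)
  (sym (count-at v P Pv≡f)) (count≤n (P ∘ punchIn v))

count-split : (P Q : Fin n → Bool) →
  count P ≡ count (λ u → P u ∧ Q u) + count (λ u → P u ∧ not (Q u))
count-split P Q = trans (sum-cong-≗ λ i → split (P i) (Q i))
  (∑-distrib-+ (λ u → 𝟙 (P u ∧ Q u)) (λ u → 𝟙 (P u ∧ not (Q u))))
  where
  split : ∀ a b → 𝟙 a ≡ 𝟙 (a ∧ b) + 𝟙 (a ∧ not b)
  split true  true  = refl
  split true  false = refl
  split false b     = refl

count-∨ : (P Q : Fin n → Bool) → (∀ u → P u ≡ true → Q u ≡ false) →
  count (λ u → P u ∨ Q u) ≡ count P + count Q
count-∨ P Q disj = trans (sum-cong-≗ λ i → join (P i) (Q i) (disj i))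
  (∑-distrib-+ (𝟙 ∘ P) (𝟙 ∘ Q))
  where
  join : ∀ a b → (a ≡ true → b ≡ false) → 𝟙 (a ∨ b) ≡ 𝟙 a + 𝟙 b
  join true  b d = sym (cong (suc ∘ 𝟙) (d refl))
  join false b d = refl

not⇒false : ∀ {b} → not b ≡ true → b ≡ false
not⇒false {false} _ = refl

true≢false : ∀ {A : Set} {b} → b ≡ true → b ≡ false → A
true≢false refl ()

count≡0 : (P : Fin n → Bool) → (∀ u → P u ≡ false) → count P ≡ 0
count≡0 {n} P none = trans (sum-cong-≗ (cong 𝟙 ∘ none)) (sum-replicate-zero n)

-- A vertex of `G` is either the deleted vertex `v` or comes from `G -ᵛ v`; this case split carries
-- statements between the two graphs in the inductions below.
punchIn-elim : (A : Fin (suc n) → Set) (v : Fin (suc n)) →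
  A v → (∀ i → A (punchIn v i)) → ∀ i → A i
punchIn-elim A v Av Ap i with v Fin.≟ i
... | yes refl = Av
... | no  v≢i  = subst A (punchIn-punchOut v≢i) (Ap (punchOut v≢i))

∣tabulate∣ : (P : Fin n → Bool) → ∣ tabulate P ∣ ≡ count P
∣tabulate∣ {zero}  P = refl
∣tabulate∣ {suc n} P with P zero
... | true  = cong suc (∣tabulate∣ (P ∘ suc))
... | false = ∣tabulate∣ (P ∘ suc)

∈-tabulate⁺ : (P : Fin n → Bool) {u : Fin n} → P u ≡ true → u ∈ tabulate P
∈-tabulate⁺ P {u} Pu = lookup⇒[]= u (tabulate P) (trans (lookup∘tabulate P u) Pu)

∈-tabulate⁻ : (P : Fin n → Bool) {u : Fin n} → u ∈ tabulate P → P u ≡ true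
∈-tabulate⁻ P {u} u∈ = trans (sym (lookup∘tabulate P u)) ([]=⇒lookup u∈)

-- Degrees and cliques under deletion and insertion of a vertex.

deg : Graph n → Fin n → ℕ
deg G v = count (adj G v)

degree≡deg : (G : Graph n) (v : Fin n) → degree G v ≡ deg G v
degree≡deg G v = ∣tabulate∣ (adj G v)

deg-at : (G : Graph (suc n)) (v : Fin (suc n)) (u : Fin n) {b : Bool} →
  adj G v (punchIn v u) ≡ b → deg G (punchIn v u) ≡ 𝟙 b + deg (G -ᵛ v) u
deg-at G v u vu = count-at v (adj G (punchIn v u)) (trans (symm G (punchIn v u) v) vu)

deg-mono : (G : Graph (suc n)) (v : Fin (suc n)) (u : Fin n) →
  deg (G -ᵛ v) u ≤ deg G (punchIn v u)
deg-mono G v u = subst (deg (G -ᵛ v) u ≤_) (sym (deg-at G v u refl)) (m≤n+m _ _)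

deg-self : (G : Graph (suc n)) (v : Fin (suc n)) → deg G v ≡ count (adj G v ∘ punchIn v)
deg-self G v = count-at v (adj G v) (irrefl G v)

-- Vertex sets are Boolean predicates from here on: restricting to `G -ᵛ v` is then composition with
-- `punchIn v`, and extending back to `G` is `insertAt`.
Cliqueᵇ : Graph n → (Fin n → Bool) → Set
Cliqueᵇ G P = ∀ u w → P u ≡ true → P w ≡ true → u ≢ w → adj G u w ≡ true

Independentᵇ : Graph n → (Fin n → Bool) → Set
Independentᵇ G P = ∀ u w → P u ≡ true → P w ≡ true → adj G u w ≡ false

neighbours-clique : (G : Graph n) (v : Fin n) → IsClique G (neighbours G v) → Cliqueᵇ G (adj G v)
neighbours-clique G v cl u w vu vw = cl u w (∈-tabulate⁺ (adj G v) vu) (∈-tabulate⁺ (adj G v) vw)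

Cliqueᵇ-⊆ : (G : Graph n) {P Q : Fin n → Bool} → P ⊆ᵇ Q → Cliqueᵇ G Q → Cliqueᵇ G P
Cliqueᵇ-⊆ G P⊆Q cl u w Pu Pw = cl u w (P⊆Q u Pu) (P⊆Q w Pw)

Cliqueᵇ-punchIn : (G : Graph (suc n)) (v : Fin (suc n)) {P : Fin (suc n) → Bool} →
  Cliqueᵇ G P → Cliqueᵇ (G -ᵛ v) (P ∘ punchIn v)
Cliqueᵇ-punchIn G v cl u w Pu Pw u≢w = cl _ _ Pu Pw (u≢w ∘ punchIn-injective v u w)

Cliqueᵇ-insertAt-false : (G : Graph (suc n)) (v : Fin (suc n)) {P : Fin n → Bool} →
  Cliqueᵇ (G -ᵛ v) P → Cliqueᵇ G (insertAt P v false)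
Cliqueᵇ-insertAt-false G v {P} cl = punchIn-elim _ v
  (λ w Pv _ → true≢false Pv (insertAt-lookup P v false))
  λ u → punchIn-elim _ v
    (λ _ Pv → true≢false Pv (insertAt-lookup P v false))
    λ w Pu Pw u≢w → cl u w (trans (sym (insertAt-punchIn P v false u)) Pu)
      (trans (sym (insertAt-punchIn P v false w)) Pw) (u≢w ∘ cong (punchIn v))

Cliqueᵇ-insertAt-true : (G : Graph (suc n)) (v : Fin (suc n)) {P : Fin n → Bool} →
  Cliqueᵇ (G -ᵛ v) P → P ⊆ᵇ adj G v ∘ punchIn v → Cliqueᵇ G (insertAt P v true)
Cliqueᵇ-insertAt-true G v {P} cl P⊆N = punchIn-elim _ v
  (punchIn-elim _ v
    (λ _ _ v≢v → contradiction refl v≢v)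
    λ w _ Pw _ → P⊆N w (trans (sym (insertAt-punchIn P v true w)) Pw))
  λ u → punchIn-elim _ v
    (λ Pu _ _ → trans (symm G (punchIn v u) v) (P⊆N u (trans (sym (insertAt-punchIn P v true u)) Pu)))
    λ w Pu Pw u≢w → cl u w (trans (sym (insertAt-punchIn P v true u)) Pu)
      (trans (sym (insertAt-punchIn P v true w)) Pw) (u≢w ∘ cong (punchIn v))

insertAt-⊆ : ∀ v (P : Fin n → Bool) b {Q : Fin (suc n) → Bool} →
  (b ≡ true → Q v ≡ true) → P ⊆ᵇ Q ∘ punchIn v → insertAt P v b ⊆ᵇ Q
insertAt-⊆ v P b b⇒Q P⊆Q = punchIn-elim _ v
  (λ t → b⇒Q (trans (sym (insertAt-lookup P v b)) t))
  λ u t → P⊆Q u (trans (sym (insertAt-punchIn P v b u)) t)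

-- Chordal graphs, given by a perfect elimination order, and their independent sets.

data IsChordal : ∀ {n} → Graph n → Set where
  empty : (G : Graph 0) → IsChordal G
  add   : (G : Graph (suc n)) (v : Fin (suc n)) →
          IsChordal (G -ᵛ v) → Cliqueᵇ G (adj G v) → IsChordal G

-- A k-tree starts from a complete graph, whereas an elimination order has to run down to the empty
-- graph; in a complete graph any vertex may go first.
complete⇒chordal : (G : Graph n) → (∀ u v → u ≢ v → adj G u v ≡ true) → IsChordal G
complete⇒chordal {zero}  G K = empty G
complete⇒chordal {suc n} G K = add G zero
  (complete⇒chordal (G -ᵛ zero) λ u v u≢v → K _ _ (u≢v ∘ punchIn-injective zero u v))
  λ u w _ _ → K u w

kTree⇒chordal : ∀ {k} {G : Graph n} → IsKTree k G → IsChordal G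
kTree⇒chordal (complete G K)      = complete⇒chordal G K
kTree⇒chordal (add G v T dv≡k cl) = add G v (kTree⇒chordal T) (neighbours-clique G v cl)

-- Greedily take the last vertex v of S in the elimination order: v and its
-- neighbours in S form a clique, so that discarding them costs at most m
-- vertices.
chordal-independent : {G : Graph n} → IsChordal G → ∀ m (S : Fin n → Bool) →
  (∀ Q → Cliqueᵇ G Q → Q ⊆ᵇ S → count Q ≤ m) →
  ∃ λ I → I ⊆ᵇ S × Independentᵇ G I × count S ≤ m * count I
chordal-independent (empty G) m S ω≤m = S , (λ _ s → s) , (λ ()) , z≤n
chordal-independent {suc n} (add G v C cl) m S ω≤m with S v in Sv
... | false =
  let I , I⊆S , ind , S≤mI = chordal-independent C m (S ∘ punchIn v) λ Q clQ Q⊆S →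
        subst (_≤ m) (count-insertAt v Q false)
          (ω≤m (insertAt Q v false) (Cliqueᵇ-insertAt-false G v clQ)
            (insertAt-⊆ v Q false (λ ()) Q⊆S))
      I⁺ = insertAt I v false
      ind⁺ : Independentᵇ G I⁺
      ind⁺ = punchIn-elim _ v
        (λ w t _ → true≢false t (insertAt-lookup I v false))
        λ u → punchIn-elim _ v (λ _ t → true≢false t (insertAt-lookup I v false))
          λ w Iu Iw → ind u w (trans (sym (insertAt-punchIn I v false u)) Iu)
                              (trans (sym (insertAt-punchIn I v false w)) Iw)
  in I⁺ , insertAt-⊆ v I false (λ ()) I⊆S , ind⁺ , (begin
    count S                 ≡⟨ count-at v S Sv ⟩
    count (S ∘ punchIn v)   ≤⟨ S≤mI ⟩
    m * count I             ≡⟨ cong (m *_) (count-insertAt v I false) ⟨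
    m * count I⁺            ∎)
  where open ≤-Reasoning
... | true =
  let N  = adj G v ∘ punchIn v
      S∩N = λ u → S (punchIn v u) ∧ N u
      S∖N = λ u → S (punchIn v u) ∧ not (N u)
      I , I⊆S∖N , ind , S∖N≤mI = chordal-independent C m S∖N λ Q clQ Q⊆S∖N →
        subst (_≤ m) (count-insertAt v Q false)
          (ω≤m (insertAt Q v false) (Cliqueᵇ-insertAt-false G v clQ)
            (insertAt-⊆ v Q false (λ ()) λ u → ∧-conicalˡ _ _ ∘ Q⊆S∖N u))
      I∌N : ∀ u → I u ≡ true → adj G v (punchIn v u) ≡ false
      I∌N u Iu = not⇒false (∧-conicalʳ (S (punchIn v u)) _ (I⊆S∖N u Iu))
      I⁺ = insertAt I v true
      ind⁺ : Independentᵇ G I⁺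
      ind⁺ = punchIn-elim _ v
        (punchIn-elim _ v (λ _ _ → irrefl G v)
          λ w _ Iw → I∌N w (trans (sym (insertAt-punchIn I v true w)) Iw))
        λ u → punchIn-elim _ v
          (λ Iu _ → trans (symm G (punchIn v u) v) (I∌N u (trans (sym (insertAt-punchIn I v true u)) Iu)))
          λ w Iu Iw → ind u w (trans (sym (insertAt-punchIn I v true u)) Iu)
                              (trans (sym (insertAt-punchIn I v true w)) Iw)
      clique≤m : suc (count S∩N) ≤ m
      clique≤m = subst (_≤ m) (count-insertAt v S∩N true)
        (ω≤m (insertAt S∩N v true)
          (Cliqueᵇ-insertAt-true G v
            (Cliqueᵇ-⊆ (G -ᵛ v) (λ u → ∧-conicalʳ (S (punchIn v u)) _) (Cliqueᵇ-punchIn G v cl))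
            (λ u → ∧-conicalʳ (S (punchIn v u)) _))
          (insertAt-⊆ v S∩N true (λ _ → Sv) λ u → ∧-conicalˡ _ _))
  in I⁺ , insertAt-⊆ v I true (λ _ → Sv) (λ u → ∧-conicalˡ _ _ ∘ I⊆S∖N u) , ind⁺ , (begin
    count S                         ≡⟨ count-at v S Sv ⟩
    suc (count (S ∘ punchIn v))     ≡⟨ cong suc (count-split (S ∘ punchIn v) N) ⟩
    suc (count S∩N) + count S∖N     ≤⟨ +-mono-≤ clique≤m S∖N≤mI ⟩
    m + m * count I                 ≡⟨ *-suc m (count I) ⟨
    m * suc (count I)               ≡⟨ cong (m *_) (count-insertAt v I true) ⟨
    m * count I⁺                    ∎)
  where open ≤-Reasoning

-- Degrees, degree sum and cliques of a k-tree.

module _ {k : ℕ} where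

  kTree-size : {G : Graph n} → IsKTree k G → suc k ≤ n
  kTree-size (complete G K)      = ≤-refl
  kTree-size (add G v T dv≡k cl) = m≤n⇒m≤1+n (kTree-size T)

  complete-deg : (G : Graph (suc k)) → (∀ u v → u ≢ v → adj G u v ≡ true) → ∀ v → deg G v ≡ k
  complete-deg G K v = trans (deg-self G v)
    (trans (sum-cong-≗ λ u → cong 𝟙 (K v (punchIn v u) (punchInᵢ≢i v u ∘ sym)))
      (trans (sum-const k 1) (*-identityʳ k)))

  -- Every vertex has degree k in the base graph or on entering, and later additions never lower a
  -- degree.
  k≤deg : {G : Graph n} → IsKTree k G → ∀ v → k ≤ deg G v
  k≤deg (complete G K)      w = ≤-reflexive (sym (complete-deg G K w))
  k≤deg (add G v T dv≡k cl) = punchIn-elim _ v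
    (≤-reflexive (trans (sym dv≡k) (degree≡deg G v)))
    λ u → ≤-trans (k≤deg T u) (deg-mono G v u)

  -- A new vertex contributes its own degree k and one more at each of its k neighbours, so each
  -- addition raises the sum by 2k. The term `k * suc k` stands on the left to avoid subtraction.
  sum-deg : {G : Graph n} → IsKTree k G → sum (deg G) + k * suc k ≡ 2 * k * n
  sum-deg (complete G K) = begin
    sum (deg G) + k * suc k  ≡⟨ cong (_+ k * suc k) (trans (sum-cong-≗ (complete-deg G K)) (sum-const (suc k) k)) ⟩
    suc k * k + k * suc k    ≡⟨ lem k ⟩
    2 * k * suc k            ∎
    where
    open ≡-Reasoning
    lem : ∀ k → suc k * k + k * suc k ≡ 2 * k * suc k
    lem = solve-∀
  sum-deg {suc n} (add G v T dv≡k cl) = begin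
    sum (deg G) + k * suc k
      ≡⟨ cong (_+ k * suc k) (sum-remove {i = v} (deg G)) ⟩
    deg G v + sum (deg G ∘ punchIn v) + k * suc k
      ≡⟨ cong (λ d → deg G v + d + k * suc k)
           (trans (sum-cong-≗ λ u → deg-at G v u refl) (∑-distrib-+ (𝟙 ∘ adj G v ∘ punchIn v) (deg (G -ᵛ v)))) ⟩
    deg G v + (count (adj G v ∘ punchIn v) + sum (deg (G -ᵛ v))) + k * suc k
      ≡⟨ cong₂ (λ a b → a + (b + sum (deg (G -ᵛ v))) + k * suc k) dv (trans (sym (deg-self G v)) dv) ⟩
    k + (k + sum (deg (G -ᵛ v))) + k * suc k
      ≡⟨ lem₁ k (sum (deg (G -ᵛ v))) (k * suc k) ⟩
    2 * k + (sum (deg (G -ᵛ v)) + k * suc k)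
      ≡⟨ cong (2 * k +_) (sum-deg T) ⟩
    2 * k + 2 * k * n
      ≡⟨ *-suc (2 * k) n ⟨
    2 * k * suc n ∎
    where
    open ≡-Reasoning
    dv : deg G v ≡ k
    dv = trans (sym (degree≡deg G v)) dv≡k
    lem₁ : ∀ k s t → k + (k + s) + t ≡ 2 * k + (s + t)
    lem₁ = solve-∀

  -- A clique through the last vertex `v` lies within `v` and its k neighbours; any other clique
  -- survives in `G -ᵛ v`.
  clique≤1+k : {G : Graph n} → IsKTree k G → ∀ P → Cliqueᵇ G P → count P ≤ suc k
  clique≤1+k (complete G K) P clP = count≤n P
  clique≤1+k (add G v T dv≡k cl) P clP with P v in Pv
  ... | false = subst (_≤ suc k) (sym (count-at v P Pv))
    (clique≤1+k T (P ∘ punchIn v) (Cliqueᵇ-punchIn G v clP))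
  ... | true  = begin
    count P                            ≡⟨ count-at v P Pv ⟩
    suc (count (P ∘ punchIn v))        ≤⟨ s≤s (count-mono λ u Pu → clP v _ Pv Pu (punchInᵢ≢i v u ∘ sym)) ⟩
    suc (count (adj G v ∘ punchIn v))  ≡⟨ cong suc (deg-self G v) ⟨
    suc (deg G v)                      ≡⟨ cong suc (trans (sym (degree≡deg G v)) dv≡k) ⟩
    suc k                              ∎
    where open ≤-Reasoning

-- Cliques of vertices of low degree.

-- A non-neighbour besides `u` itself would leave at most n - 2 vertices for the neighbourhood of
-- `u`.
dominating : (G : Graph n) (u : Fin n) → n ≤ suc (deg G u) → ∀ w → u ≢ w → adj G u w ≡ true
dominating {suc zero} G zero _ zero u≢w = contradiction refl u≢w
dominating {suc (suc n)} G u n≤ = punchIn-elim _ u (contradiction refl) λ w _ → helper w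
  where
  helper : ∀ w → adj G u (punchIn u w) ≡ true
  helper w with adj G u (punchIn u w) in eq
  ... | true  = refl
  ... | false = contradiction
    (≤-trans n≤ (s≤s (subst (_≤ n) (sym (deg-self G u)) (count-false w (adj G u ∘ punchIn u) eq)))) (n≮n (suc n))

does⇒ : {A : Set} (a? : Dec A) → does a? ≡ true → A
does⇒ (yes a) _ = a

does-false⇒ : {A : Set} (a? : Dec A) → does a? ≡ false → A → ∀ {B : Set} → B
does-false⇒ (no ¬a) _ a = contradiction a ¬a

-- When G has exactly k + 1 + m vertices, the vertices of P that dominate G - v
-- cannot be adjacent to v; together with the neighbours of v they form a
-- clique, so there is at most one of them.
low-degree-clique : ∀ {k} {G : Graph n} → IsKTree k G → ∀ m → suc k + m ≤ n →
  ∀ P → Cliqueᵇ G P → (∀ u → P u ≡ true → deg G u < k + m) → count P ≤ m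
low-degree-clique {k = k} T zero _ P clP low = ≤-reflexive (count≡0 P none)
  where
  none : ∀ u → P u ≡ false
  none u with P u in Pu
  ... | false = refl
  ... | true  = contradiction (≤-trans (low u Pu) (≤-reflexive (+-identityʳ k))) (≤⇒≯ (k≤deg T u))
low-degree-clique {k = k} (complete G K) (suc m) size P clP low =
  contradiction (≤-trans (≤-reflexive (sym (+-suc (suc k) m))) size) (m+1+n≰m (suc k) ∘ ≤-trans (≤-reflexive (+-suc (suc k) m)))
low-degree-clique {suc n} {k} (add G v T dv≡k cl) (suc m) size P clP low with P v in Pv
-- Each other vertex of `P` is a neighbour of `v` and loses one degree when `v` goes, so the
-- induction hypothesis applies with `m` in place of `suc m`.
... | true = begin
  count P                      ≡⟨ count-at v P Pv ⟩
  suc (count (P ∘ punchIn v))  ≤⟨ s≤s (low-degree-clique T m (s≤s⁻¹ (subst (_≤ suc n) (+-suc (suc k) m) size))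
                                    (P ∘ punchIn v) (Cliqueᵇ-punchIn G v clP) low′) ⟩
  suc m                        ∎
  where
  open ≤-Reasoning
  low′ : ∀ u → P (punchIn v u) ≡ true → deg (G -ᵛ v) u < k + m
  low′ u Pu = s≤s⁻¹ (subst₂ _<_
    (deg-at G v u (clP v _ Pv Pu (punchInᵢ≢i v u ∘ sym)))
    (+-suc k m) (low _ Pu))
... | false = subst (_≤ suc m) (sym (count-at v P Pv)) (rest (suc k + suc m ≤? n))
  where
  open ≤-Reasoning
  P⁻ N L P∩L D : Fin n → Bool
  P⁻ = P ∘ punchIn v
  N  = adj G v ∘ punchIn v
  -- The induction hypothesis for `m` covers the vertices of `P` in `L`; those that it misses form
  -- `D`.
  L u = does (suc (deg (G -ᵛ v) u) ≤? k + m)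
  P∩L u = P⁻ u ∧ L u
  D u = P⁻ u ∧ not (L u)
  clP⁻ : Cliqueᵇ (G -ᵛ v) P⁻
  clP⁻ = Cliqueᵇ-punchIn G v clP
  size⁻ : suc k + m ≤ n
  size⁻ = s≤s⁻¹ (subst (_≤ suc n) (+-suc (suc k) m) size)
  rest : Dec (suc k + suc m ≤ n) → count P⁻ ≤ suc m
  -- Here `G -ᵛ v` is still large enough for `suc m`, and deletion does not raise degrees.
  rest (yes size′) = low-degree-clique T (suc m) size′ P⁻ clP⁻ λ u Pu →
    ≤-<-trans (deg-mono G v u) (low _ Pu)
  rest (no size≰) = begin
    count P⁻            ≡⟨ count-split P⁻ L ⟩
    count P∩L + count D ≤⟨ +-mono-≤
      (low-degree-clique T m size⁻ P∩L (Cliqueᵇ-⊆ (G -ᵛ v) (λ u → ∧-conicalˡ _ _) clP⁻)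
        λ u t → does⇒ (suc (deg (G -ᵛ v) u) ≤? k + m) (∧-conicalʳ (P⁻ u) _ t))
      D≤1 ⟩
    m + 1               ≡⟨ +-comm m 1 ⟩
    suc m               ∎
    where
    high : ∀ u → D u ≡ true → k + m ≤ deg (G -ᵛ v) u
    high u t = ≮⇒≥ λ lt → does-false⇒ (suc (deg (G -ᵛ v) u) ≤? k + m)
      (not⇒false (∧-conicalʳ (P⁻ u) _ t)) lt
    n≤ : n ≤ suc (k + m)
    n≤ = s≤s⁻¹ (subst (n <_) (cong suc (+-suc k m)) (≰⇒> size≰))
    dom : ∀ u → D u ≡ true → ∀ w → u ≢ w → adj (G -ᵛ v) u w ≡ true
    dom u t = dominating (G -ᵛ v) u (≤-trans n≤ (s≤s (high u t)))
    disjoint : ∀ u → D u ≡ true → N u ≡ false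
    disjoint u t with N u in Nu
    ... | false = refl
    ... | true  = contradiction (high u t) (<⇒≱ (s≤s⁻¹ (subst₂ _<_
      (deg-at G v u Nu) (+-suc k m) (low _ (∧-conicalˡ _ _ t)))))
    D∪N : Fin n → Bool
    D∪N u = D u ∨ N u
    clD∪N : Cliqueᵇ (G -ᵛ v) D∪N
    clD∪N u w tu tw u≢w with D u in Du | D w in Dw
    ... | true  | _     = dom u Du w u≢w
    ... | false | true  = trans (symm (G -ᵛ v) u w) (dom w Dw u (u≢w ∘ sym))
    ... | false | false = Cliqueᵇ-punchIn G v (neighbours-clique G v cl) u w tu tw u≢w
    countN : count N ≡ k
    countN = trans (sym (deg-self G v)) (trans (sym (degree≡deg G v)) dv≡k)
    D≤1 : count D ≤ 1
    D≤1 = +-cancelʳ-≤ k (count D) 1 (begin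
      count D + k        ≡⟨ cong (count D +_) countN ⟨
      count D + count N  ≡⟨ count-∨ D N disjoint ⟨
      count D∪N          ≤⟨ clique≤1+k T D∪N clD∪N ⟩
      suc k               ∎)

-- The sizes of the degree classes in terms of the regular independence number.

∈-subsets : (S : Subset n) → S List.∈ subsets n
∈-subsets []          = here refl
∈-subsets (true  ∷ S) = ∈-++⁺ˡ (∈-map⁺ (true ∷_) (∈-subsets S))
∈-subsets (false ∷ S) = ∈-++⁺ʳ (List.map (true ∷_) (subsets _)) (∈-map⁺ (false ∷_) (∈-subsets S))

count≤αreg : (G : Graph n) (I : Fin n → Bool) → Independentᵇ G I →
  (∀ u w → I u ≡ true → I w ≡ true → deg G u ≡ deg G w) → count I ≤ αreg G
count≤αreg G I ind reg = v≤max⁺ 0 _ (inj₂ (List.lose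
  (∈-map⁺ ∣_∣ (∈-filter⁺ (isRegularIndependent? G) (∈-subsets (tabulate I)) (ind′ , reg′)))
  (≤-reflexive (sym (∣tabulate∣ I)))))
  where
  ind′ : IsIndependent G (tabulate I)
  ind′ u w u∈ w∈ = ind u w (∈-tabulate⁻ I u∈) (∈-tabulate⁻ I w∈)
  reg′ : IsRegular G (tabulate I)
  reg′ u w u∈ w∈ = trans (degree≡deg G u)
    (trans (reg u w (∈-tabulate⁻ I u∈) (∈-tabulate⁻ I w∈)) (sym (degree≡deg G w)))

level : Graph n → ℕ → Fin n → Bool
level G d u = does (deg G u ≟ d)

module _ {k : ℕ} {G : Graph n} (T : IsKTree k G) where

  -- An independent set inside a single degree class is automatically regular, so the set found by
  -- `chordal-independent` is counted by `αreg G`.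
  level≤m*αreg : ∀ d m → (∀ Q → Cliqueᵇ G Q → Q ⊆ᵇ level G d → count Q ≤ m) →
    count (level G d) ≤ m * αreg G
  level≤m*αreg d m ω≤m =
    let I , I⊆L , ind , L≤mI = chordal-independent (kTree⇒chordal T) m (level G d) ω≤m
        degI : ∀ u → I u ≡ true → deg G u ≡ d
        degI u Iu = does⇒ (deg G u ≟ d) (I⊆L u Iu)
    in ≤-trans L≤mI (*-monoʳ-≤ m
         (count≤αreg G I ind λ u w Iu Iw → trans (degI u Iu) (sym (degI w Iw))))

  level≤[1+k]*αreg : ∀ d → count (level G d) ≤ suc k * αreg G
  level≤[1+k]*αreg d = level≤m*αreg d (suc k) λ Q clQ _ → clique≤1+k T Q clQ

  -- For j below k this improves on the factor `suc k`. Since `low-degree-clique` asks for degrees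
  -- strictly below `k + m`, degree `k + j` calls for `m = suc j`.
  low-level≤ : ∀ j → suc k + suc j ≤ n → count (level G (k + j)) ≤ suc j * αreg G
  low-level≤ j size = level≤m*αreg (k + j) (suc j) λ Q clQ Q⊆L →
    low-degree-clique T (suc j) size Q clQ λ u Qu →
      ≤-reflexive (trans (cong suc (does⇒ (deg G u ≟ k + j) (Q⊆L u Qu))) (sym (+-suc k j)))

  -- The degree class of any vertex is nonempty, which the preceding bound excludes if `αreg G` is
  -- 0. This settles the case of at most 2k vertices.
  αreg-positive : 1 ≤ αreg G
  αreg-positive = positive (αreg G) (≤-trans 1≤level (level≤[1+k]*αreg (deg G v)))
    where
    some-vertex : ∀ {m} → suc k ≤ m → Fin m
    some-vertex (s≤s _) = zero
    v = some-vertex (kTree-size T)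
    1≤level : 1 ≤ count (level G (deg G v))
    1≤level = subst (_≤ count (level G (deg G v))) (cong 𝟙 (dec-true (deg G v ≟ deg G v) refl))
      (term≤sum (𝟙 ∘ level G (deg G v)) v)
    positive : ∀ a → 1 ≤ suc k * a → 1 ≤ a
    positive zero    p = subst (1 ≤_) (*-zeroʳ (suc k)) p
    positive (suc a) p = s≤s z≤n

-- Weights by degree and closed forms for the weighted sums.

-- The weight of a vertex is spread over indicators of degree classes, so that summation over the
-- vertices produces class sizes. The two sums separate the degrees from k to 2k - 1, where the
-- class bound grows with j, from those between 2k and 3k - 1, where it is constant; from 3k on the
-- weight vanishes.
3k∸d-layers : ∀ k d → k ≤ d → 3 * k ∸ d ≤
  ∑[ j < k ] (𝟙 (does (d ≟ k + toℕ j)) * (k + (k ∸ toℕ j))) +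
  ∑[ j < k ] (𝟙 (does (d ≟ k + (k + toℕ j))) * (k ∸ toℕ j))
3k∸d-layers k d k≤d = subst (λ d → 3 * k ∸ d ≤ sum (f d) + sum (g d)) (m+[n∸m]≡n k≤d) (layers (d ∸ k))
  where
  open ≤-Reasoning
  f g : ℕ → Fin k → ℕ
  f d j = 𝟙 (does (d ≟ k + toℕ j)) * (k + (k ∸ toℕ j))
  g d j = 𝟙 (does (d ≟ k + (k + toℕ j))) * (k ∸ toℕ j)
  hit : ∀ a b x → a ≡ b → 𝟙 (does (a ≟ b)) * x ≡ x
  hit a b x a≡b = trans (cong (λ b → 𝟙 b * x) (dec-true (a ≟ b) a≡b)) (+-identityʳ x)
  3k∸ : ∀ e → 3 * k ∸ (k + e) ≡ k + k ∸ e
  3k∸ e = trans ([m+n]∸[m+o]≡n∸o k (k + (k + 0)) e) (cong (λ x → k + x ∸ e) (+-identityʳ k))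
  layers : ∀ e → 3 * k ∸ (k + e) ≤ sum (f (k + e)) + sum (g (k + e))
  layers e with e <? k
  ... | yes e<k = begin
    3 * k ∸ (k + e)            ≡⟨ 3k∸ e ⟩
    k + k ∸ e                  ≡⟨ +-∸-assoc k (<⇒≤ e<k) ⟩
    k + (k ∸ e)                ≡⟨ cong (λ x → k + (k ∸ x)) (toℕ-fromℕ< e<k) ⟨
    k + (k ∸ toℕ j)            ≡⟨ hit (k + e) (k + toℕ j) _ (cong (k +_) (sym (toℕ-fromℕ< e<k))) ⟨
    f (k + e) j                ≤⟨ term≤sum (f (k + e)) j ⟩
    sum (f (k + e))            ≤⟨ m≤m+n _ _ ⟩
    sum (f (k + e)) + sum (g (k + e)) ∎
    where j = fromℕ< e<k
  ... | no  e≮k with e ∸ k | m+[n∸m]≡n (≮⇒≥ e≮k)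
  ...   | e′ | refl with e′ <? k
  ...     | no  e′≮k = subst (_≤ sum (f (k + (k + e′))) + sum (g (k + (k + e′))))
    (sym (trans (3k∸ (k + e′)) (trans ([m+n]∸[m+o]≡n∸o k k e′) (m≤n⇒m∸n≡0 (≮⇒≥ e′≮k))))) z≤n
  ...     | yes e′<k = begin
    3 * k ∸ (k + (k + e′))    ≡⟨ 3k∸ (k + e′) ⟩
    k + k ∸ (k + e′)          ≡⟨ [m+n]∸[m+o]≡n∸o k k e′ ⟩
    k ∸ e′                    ≡⟨ cong (k ∸_) (toℕ-fromℕ< e′<k) ⟨
    k ∸ toℕ j                 ≡⟨ hit (k + (k + e′)) (k + (k + toℕ j)) _
                                   (cong (λ x → k + (k + x)) (sym (toℕ-fromℕ< e′<k))) ⟨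
    g (k + (k + e′)) j        ≤⟨ term≤sum (g (k + (k + e′))) j ⟩
    sum (g (k + (k + e′)))    ≤⟨ m≤n+m _ (sum (f (k + (k + e′)))) ⟩
    sum (f (k + (k + e′))) + sum (g (k + (k + e′))) ∎
    where j = fromℕ< e′<k

-- Double counting: exchanging the two sums turns the indicators of each class into its size.
weighted-count : ∀ {m} (P : Fin m → Fin n → Bool) (c w : Fin m → ℕ) a →
  (∀ j → count (P j) ≤ w j * a) →
  ∑[ u < n ] ∑[ j < m ] (𝟙 (P j u) * c j) ≤ a * ∑[ j < m ] (w j * c j)
weighted-count {n} {m} P c w a P≤wa = begin
  ∑[ u < n ] ∑[ j < m ] (𝟙 (P j u) * c j)  ≡⟨ ∑-comm (λ u j → 𝟙 (P j u) * c j) ⟩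
  ∑[ j < m ] ∑[ u < n ] (𝟙 (P j u) * c j)  ≡⟨ sum-cong-≗ (λ j → *-distribʳ-sum (c j) (𝟙 ∘ P j)) ⟨
  ∑[ j < m ] (count (P j) * c j)           ≤⟨ sum-mono (λ j → *-monoˡ-≤ (c j) (P≤wa j)) ⟩
  ∑[ j < m ] (w j * a * c j)               ≡⟨ sum-cong-≗ (λ j → lem (w j) a (c j)) ⟩
  ∑[ j < m ] (a * (w j * c j))             ≡⟨ *-distribˡ-sum a (λ j → w j * c j) ⟨
  a * ∑[ j < m ] (w j * c j)               ∎
  where
  open ≤-Reasoning
  lem : ∀ w a c → w * a * c ≡ a * (w * c)
  lem = solve-∀

triangular : ∀ m → 2 * ∑[ j < m ] (m ∸ toℕ j) ≡ m * suc m
triangular zero    = refl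
triangular (suc m) = trans (*-distribˡ-+ 2 (suc m) (∑[ j < m ] (m ∸ toℕ j)))
  (trans (cong (2 * suc m +_) (triangular m)) (lem m))
  where
  lem : ∀ m → 2 * suc m + m * suc m ≡ suc m * suc (suc m)
  lem = solve-∀

-- The offset b is only there to make the induction on m go through.
tetrahedral : ∀ b c m → 6 * ∑[ j < m ] ((suc b + toℕ j) * (c + (m ∸ toℕ j))) ≡
  b * (6 * c * m + 3 * m * suc m) + m * suc m * (3 * c + m + 2)
tetrahedral b c zero    = sym (trans (+-identityʳ _) (lem b c))
  where
  lem : ∀ b c → b * (6 * c * 0 + 0) ≡ 0
  lem = solve-∀
tetrahedral b c (suc m) = begin
  6 * ((suc b + 0) * (c + suc m) + ∑[ j < m ] ((suc b + suc (toℕ j)) * (c + (m ∸ toℕ j))))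
    ≡⟨ cong (λ s → 6 * ((suc b + 0) * (c + suc m) + s))
         (sum-cong-≗ {m} λ j → cong (_* (c + (m ∸ toℕ j))) (+-suc (suc b) (toℕ j))) ⟩
  6 * ((suc b + 0) * (c + suc m) + ∑[ j < m ] ((suc (suc b) + toℕ j) * (c + (m ∸ toℕ j))))
    ≡⟨ *-distribˡ-+ 6 ((suc b + 0) * (c + suc m)) _ ⟩
  6 * ((suc b + 0) * (c + suc m)) + 6 * ∑[ j < m ] ((suc (suc b) + toℕ j) * (c + (m ∸ toℕ j)))
    ≡⟨ cong (6 * ((suc b + 0) * (c + suc m)) +_) (tetrahedral (suc b) c m) ⟩
  6 * ((suc b + 0) * (c + suc m)) + (suc b * (6 * c * m + 3 * m * suc m) + m * suc m * (3 * c + m + 2))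
    ≡⟨ lem b c m ⟩
  b * (6 * c * suc m + 3 * suc m * suc (suc m)) + suc m * suc (suc m) * (3 * c + suc m + 2) ∎
  where
  open ≡-Reasoning
  lem : ∀ b c m →
    6 * ((suc b + 0) * (c + suc m)) + (suc b * (6 * c * m + 3 * m * suc m) + m * suc m * (3 * c + m + 2))
    ≡ b * (6 * c * suc m + 3 * suc m * suc (suc m)) + suc m * suc (suc m) * (3 * c + suc m + 2)
  lem = solve-∀

-- The inequality between the order and the regular independence number in ℕ.

module _ {k : ℕ} {G : Graph n} (T : IsKTree k G) where

  private
    -- `T₁` and `T₂` add up class bound times weight, the class bound being taken per unit of `a`,
    -- over the degrees below 2k and from 2k on.
    a T₁ T₂ : ℕ
    a  = αreg G
    T₁ = ∑[ j < k ] (suc (toℕ j) * (k + (k ∸ toℕ j)))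
    T₂ = ∑[ j < k ] (suc k * (k ∸ toℕ j))

  sum-3k∸deg≤ : suc (2 * k) ≤ n → ∑[ u < n ] (3 * k ∸ deg G u) ≤ a * (T₁ + T₂)
  sum-3k∸deg≤ 2k<n = begin
    ∑[ u < n ] (3 * k ∸ deg G u)
      ≤⟨ sum-mono (λ u → 3k∸d-layers k (deg G u) (k≤deg T u)) ⟩
    ∑[ u < n ] (∑[ j < k ] f u j + ∑[ j < k ] g u j)
      ≡⟨ ∑-distrib-+ (λ u → ∑[ j < k ] f u j) (λ u → ∑[ j < k ] g u j) ⟩
    ∑[ u < n ] ∑[ j < k ] f u j + ∑[ u < n ] ∑[ j < k ] g u j
      ≤⟨ +-mono-≤
           (weighted-count {m = k} (λ j → level G (k + toℕ j)) (λ j → k + (k ∸ toℕ j)) (suc ∘ toℕ) a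
             λ j → low-level≤ T (toℕ j) (≤-trans (size j) 2k<n))
           (weighted-count {m = k} (λ j → level G (k + (k + toℕ j))) (λ j → k ∸ toℕ j) (λ _ → suc k) a
             λ j → level≤[1+k]*αreg T (k + (k + toℕ j))) ⟩
    a * T₁ + a * T₂
      ≡⟨ *-distribˡ-+ a T₁ T₂ ⟨
    a * (T₁ + T₂) ∎
    where
    open ≤-Reasoning
    f g : Fin n → Fin k → ℕ
    f u j = 𝟙 (level G (k + toℕ j) u) * (k + (k ∸ toℕ j))
    g u j = 𝟙 (level G (k + (k + toℕ j)) u) * (k ∸ toℕ j)
    -- The last class, j = k - 1, is the most demanding: it needs (k + 1) + k vertices, which is
    -- where n > 2k comes from.
    size : (j : Fin k) → suc k + suc (toℕ j) ≤ suc (2 * k)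
    size j = +-monoʳ-≤ (suc k) (≤-trans (toℕ<n j) (≤-reflexive (sym (+-identityʳ k))))

  -- Without truncation the right-hand side would be 3kn minus the degree sum 2kn - k(k + 1), and
  -- truncation can only increase it. Adding `2 * k * n` to both sides keeps the computation in ℕ.
  kn+k[k+1]≤ : k * n + k * suc k ≤ ∑[ u < n ] (3 * k ∸ deg G u)
  kn+k[k+1]≤ = +-cancelˡ-≤ (2 * k * n) _ _ (begin
    2 * k * n + (k * n + k * suc k)                          ≡⟨ lem k n ⟩
    n * (3 * k) + k * suc k                                  ≡⟨ cong (_+ k * suc k) (sum-const n (3 * k)) ⟨
    ∑[ u < n ] (3 * k) + k * suc k                           ≤⟨ +-monoˡ-≤ (k * suc k) (sum-mono λ u → m≤n+m∸n (3 * k) (deg G u)) ⟩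
    ∑[ u < n ] (deg G u + (3 * k ∸ deg G u)) + k * suc k     ≡⟨ cong (_+ k * suc k) (∑-distrib-+ (deg G) (λ u → 3 * k ∸ deg G u)) ⟩
    sum (deg G) + S + k * suc k                              ≡⟨ lem₁ (sum (deg G)) S (k * suc k) ⟩
    sum (deg G) + k * suc k + S                              ≡⟨ cong (_+ S) (sum-deg T) ⟩
    2 * k * n + S                                            ∎)
    where
    open ≤-Reasoning
    S = ∑[ u < n ] (3 * k ∸ deg G u)
    lem : ∀ k n → 2 * k * n + (k * n + k * suc k) ≡ n * (3 * k) + k * suc k
    lem = solve-∀
    lem₁ : ∀ a b c → a + b + c ≡ a + c + b
    lem₁ = solve-∀

  -- The factor 6 clears the denominators of the closed forms `tetrahedral`, at offset 0 and c = k,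
  -- and `triangular`.
  6[T₁+T₂] : 6 * (T₁ + T₂) ≡ k * (suc k * (7 * k + 5))
  6[T₁+T₂] = begin
    6 * (T₁ + T₂)
      ≡⟨ cong (λ t → 6 * (T₁ + t)) (*-distribˡ-sum (suc k) (λ (j : Fin k) → k ∸ toℕ j)) ⟨
    6 * (T₁ + suc k * ∑[ j < k ] (k ∸ toℕ j))
      ≡⟨ lem₁ T₁ (suc k) (∑[ j < k ] (k ∸ toℕ j)) ⟩
    6 * T₁ + 3 * suc k * (2 * ∑[ j < k ] (k ∸ toℕ j))
      ≡⟨ cong₂ (λ s t → s + 3 * suc k * t) (tetrahedral 0 k k) (triangular k) ⟩
    k * suc k * (3 * k + k + 2) + 3 * suc k * (k * suc k)
      ≡⟨ lem₂ k ⟩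
    k * (suc k * (7 * k + 5)) ∎
    where
    open ≡-Reasoning
    lem₁ : ∀ s k t → 6 * (s + k * t) ≡ 6 * s + 3 * k * (2 * t)
    lem₁ = solve-∀
    lem₂ : ∀ k → k * suc k * (3 * k + k + 2) + 3 * suc k * (k * suc k) ≡ k * (suc k * (7 * k + 5))
    lem₂ = solve-∀

  6n<αreg : .{{NonZero k}} → 6 * n < a * (suc k * (7 * k + 5))
  6n<αreg with suc (2 * k) ≤? n
  -- Here a ≥ 1 is enough, because (k + 1)(7k + 5) = 12k + 7k² + 5 exceeds 6 · 2k.
  ... | no  2k≮n = begin-strict
    6 * n                        ≤⟨ *-monoʳ-≤ 6 (≮⇒≥ 2k≮n) ⟩
    6 * (2 * k)                  <⟨ m≤n⇒m≤n+o (7 * k * k + 4) ≤-refl ⟩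
    suc (6 * (2 * k)) + (7 * k * k + 4) ≡⟨ lem k ⟩
    suc k * (7 * k + 5)          ≡⟨ *-identityˡ _ ⟨
    1 * (suc k * (7 * k + 5))    ≤⟨ *-monoˡ-≤ (suc k * (7 * k + 5)) (αreg-positive T) ⟩
    a * (suc k * (7 * k + 5))    ∎
    where
    open ≤-Reasoning
    lem : ∀ k → suc (6 * (2 * k)) + (7 * k * k + 4) ≡ suc k * (7 * k + 5)
    lem = solve-∀
  -- After multiplication by k, the term 6k(k + 1) pays for strictness: it splits into k, which
  -- turns 6n into 6n + 1, and the surplus k(6k + 5).
  ... | yes 2k<n = *-cancelˡ-≤ k (begin
    k * suc (6 * n)                       ≤⟨ m≤m+n _ (k * (6 * k + 5)) ⟩
    k * suc (6 * n) + k * (6 * k + 5)     ≡⟨ lem k n ⟩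
    6 * (k * n + k * suc k)               ≤⟨ *-monoʳ-≤ 6 (≤-trans kn+k[k+1]≤ (sum-3k∸deg≤ 2k<n)) ⟩
    6 * (a * (T₁ + T₂))                   ≡⟨ lem₁ 6 a (T₁ + T₂) ⟩
    a * (6 * (T₁ + T₂))                   ≡⟨ cong (a *_) 6[T₁+T₂] ⟩
    a * (k * (suc k * (7 * k + 5)))       ≡⟨ lem₁ a k (suc k * (7 * k + 5)) ⟩
    k * (a * (suc k * (7 * k + 5)))       ∎)
    where
    open ≤-Reasoning
    lem : ∀ k n → k * suc (6 * n) + k * (6 * k + 5) ≡ 6 * (k * n + k * suc k)
    lem = solve-∀
    lem₁ : ∀ a b c → a * (b * c) ≡ b * (a * c)
    lem₁ = solve-∀

-- A lower bound for the denominator, term by term.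

open import Data.Integer.Base using (+_)

-- This is 4√(8k - 7) ≤ 5k + 2 in squared form. For k = j + 2 the difference of the two sides is
-- j(25j - 8), which is nonnegative on the naturals and vanishes at k = 2.
16[8k-7]≤ : ∀ k → 2 ≤ k → 16 * (8 * k ∸ 7) ≤ (5 * k + 2) * (5 * k + 2)
16[8k-7]≤ (suc (suc j)) (s≤s (s≤s _)) = begin
  16 * (8 * (2 + j) ∸ 7)                     ≡⟨ cong (λ x → 16 * (x ∸ 7)) (lem₁ j) ⟩
  16 * (9 + 8 * j)                           ≡⟨ lem₂ j ⟩
  144 + 120 * j + 8 * j                    ≤⟨ +-monoʳ-≤ (144 + 120 * j) (*-mono-≤ (m≤m+n 8 17) (j≤j² j)) ⟩
  144 + 120 * j + 25 * (j * j)             ≡⟨ lem₃ j ⟩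
  (5 * (2 + j) + 2) * (5 * (2 + j) + 2) ∎
  where
  open ≤-Reasoning
  j≤j² : ∀ j → j ≤ j * j
  j≤j² zero    = z≤n
  j≤j² (suc j) = m≤m*n (suc j) (suc j)
  lem₁ : ∀ j → 8 * (2 + j) ≡ 7 + (9 + 8 * j)
  lem₁ = solve-∀
  lem₂ : ∀ j → 16 * (9 + 8 * j) ≡ 144 + 120 * j + 8 * j
  lem₂ = solve-∀
  lem₃ : ∀ j → 144 + 120 * j + 25 * (j * j) ≡ (5 * (2 + j) + 2) * (5 * (2 + j) + 2)
  lem₃ = solve-∀

ι4*c/4 : ∀ c → ι 4 ℚ.* ((+ c) ℚ./ 4) ≡ ι c
ι4*c/4 c = ℚ.toℚᵘ-injective (begin
  ℚ.toℚᵘ (ι 4 ℚ.* ((+ c) ℚ./ 4))              ≈⟨ ℚ.toℚᵘ-homo-* (ι 4) ((+ c) ℚ./ 4) ⟩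
  ℚ.toℚᵘ (ι 4) ℚᵘ.* ℚ.toℚᵘ ((+ c) ℚ./ 4)      ≈⟨ ℚᵘ.*-congˡ {ℚ.toℚᵘ (ι 4)} (ℚ.toℚᵘ-fromℚᵘ (mkℚᵘ (+ c) 3)) ⟩
  mkℚᵘ (+ 4) 0 ℚᵘ.* mkℚᵘ (+ c) 3              ≈⟨ ℚᵘ.*≡* (trans (ℤ.*-identityʳ ((+ 4) ℤ.* (+ c))) (ℤ.*-comm (+ 4) (+ c))) ⟩
  mkℚᵘ (+ c) 0                                ≈⟨ ℚ.toℚᵘ-fromℚᵘ (mkℚᵘ (+ c) 0) ⟨
  ℚ.toℚᵘ (ι c)                                ∎)
  where open ℚᵘ.≃-Reasoning

-- The approximations of the root are rounded down, so a bound on the root itself holds for every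
-- term.
4√≤ : ∀ d c → 16 * d ≤ c * c → ∀ m → ι 4 ℚ.* seq (√ d) m ℚ.≤ ι c
4√≤ d c 16d≤c² m = subst (ι 4 ℚ.* √-approx d m ℚ.≤_) (ι4*c/4 c)
  -- The term is compared with c / 4; the argument 3 encodes the denominator 4.
  (ℚ.*-monoˡ-≤-nonNeg (ι 4) (/-≤ r c m 3 (square-cancel-≤ (r * 4) (c * M) (begin
    r * 4 * (r * 4)        ≡⟨ lem₁ r ⟩
    16 * (r * r)           ≤⟨ *-monoʳ-≤ 16 (isqrt-lower (d * (M * M))) ⟩
    16 * (d * (M * M))     ≡⟨ *-assoc 16 d (M * M) ⟨
    16 * d * (M * M)       ≤⟨ *-monoˡ-≤ (M * M) 16d≤c² ⟩
    c * c * (M * M)        ≡⟨ lem₂ c M ⟩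
    c * M * (c * M)        ∎))))
  where
  open ≤-Reasoning
  M = suc m
  r = isqrt (d * (M * M))
  lem₁ : ∀ r → r * 4 * (r * 4) ≡ 16 * (r * r)
  lem₁ = solve-∀
  lem₂ : ∀ c M → c * c * (M * M) ≡ c * M * (c * M)
  lem₂ = solve-∀

-- Four times the wanted bound, with 4√(8k - 7) replaced by 5k + 2 and the negative terms moved
-- across. The cubes cancel, and the slack 112k² - 303k + 170 is positive from k = 2 on.
scaled-denominator-bound : ∀ k → 2 ≤ k →
  4 * (4 * k * (suc k * (7 * k + 5))) + 4 * (72 * k) + 16 * k ^ 2 * (5 * k + 2)
    ≤ 4 * (48 * k ^ 3) + 4 * (84 * k ^ 2) + 13 * (5 * k + 2) + 4 * 36
scaled-denominator-bound (suc (suc j)) (s≤s (s≤s _)) = m+n≤o⇒m≤o _ (≤-reflexive (lem j))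
  where
  lem : ∀ j →
    4 * (4 * (2 + j) * ((3 + j) * (7 * (2 + j) + 5))) + 4 * (72 * (2 + j)) + 16 * ((2 + j) * ((2 + j) * 1)) * (5 * (2 + j) + 2)
      + (112 * (j * j) + 145 * j + 12)
    ≡ 4 * (48 * ((2 + j) * ((2 + j) * ((2 + j) * 1)))) + 4 * (84 * ((2 + j) * ((2 + j) * 1))) + 13 * (5 * (2 + j) + 2) + 4 * 36
  lem = solve-∀

0≤p*q : ∀ {p q} → 0ℚ ℚ.≤ p → 0ℚ ℚ.≤ q → 0ℚ ℚ.≤ p ℚ.* q
0≤p*q {p} {q} 0≤p 0≤q = subst (ℚ._≤ p ℚ.* q) (ℚ.*-zeroʳ p)
  (ℚ.*-monoˡ-≤-nonNeg p {{ℚ.nonNegative 0≤p}} 0≤q)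

0≤inv : ∀ {p} → 0ℚ ℚ.< p → 0ℚ ℚ.≤ inv p
0≤inv {p} 0<p with p ℚ.≟ 0ℚ
... | yes _   = ℚ.≤-refl
... | no  p≢0 = ℚ.<⇒≤ (ℚ.positive⁻¹ _ {{ℚ.1/pos⇒pos p {{ℚ.positive 0<p}}}})

≤denominator : ∀ k → 2 ≤ k → ∀ m → ι (4 * k * (suc k * (7 * k + 5))) ℚ.≤ seq (denominator k) m
≤denominator k 2≤k m = ℚ.*-cancelˡ-≤-pos (ι 4)
  (estimate (ι 4) (ι M) (ι (48 * k ^ 3)) (ι (84 * k ^ 2)) (ι (72 * k)) (ι (16 * k ^ 2)) (ι 13) (ι 36)
    (√-approx (8 * k ∸ 7) m) (ι (5 * k + 2))
    (ι-mono (13≤16k² k 2≤k)) (4√≤ (8 * k ∸ 7) (5 * k + 2) (16[8k-7]≤ k 2≤k) m)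
    (subst₂ ℚ._≤_ lhs rhs (ι-mono (scaled-denominator-bound k 2≤k))))
  where
  M = 4 * k * (suc k * (7 * k + 5))
  -- The right side minus the left is the slack of the last hypothesis plus (D - E)(u - qs), and
  -- both are nonnegative; s is a term of the root and u/q its upper bound.
  estimate : ∀ q M A B C D E F s u → E ℚ.≤ D → q ℚ.* s ℚ.≤ u →
    q ℚ.* M ℚ.+ q ℚ.* C ℚ.+ D ℚ.* u ℚ.≤ q ℚ.* A ℚ.+ q ℚ.* B ℚ.+ E ℚ.* u ℚ.+ q ℚ.* F →
    q ℚ.* M ℚ.≤ q ℚ.* (A ℚ.+ B ℚ.- C ℚ.- (D ℚ.- E) ℚ.* s ℚ.+ F)
  estimate q M A B C D E F s u E≤D qs≤u P≤Q = subst₂ ℚ._≤_ (ℚ.+-identityˡ (q ℚ.* M))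
    (lem q M A B C D E F s u)
    (ℚ.+-monoˡ-≤ (q ℚ.* M)
      (ℚ.+-mono-≤ (p≤q⇒0≤q-p P≤Q) (0≤p*q (p≤q⇒0≤q-p E≤D) (p≤q⇒0≤q-p qs≤u))))
    where
    lem : ∀ q M A B C D E F s u →
      ((q ℚ.* A ℚ.+ q ℚ.* B ℚ.+ E ℚ.* u ℚ.+ q ℚ.* F) ℚ.- (q ℚ.* M ℚ.+ q ℚ.* C ℚ.+ D ℚ.* u))
        ℚ.+ (D ℚ.- E) ℚ.* (u ℚ.- q ℚ.* s) ℚ.+ q ℚ.* M
      ≡ q ℚ.* (A ℚ.+ B ℚ.- C ℚ.- (D ℚ.- E) ℚ.* s ℚ.+ F)
    lem = solve 10 (λ q M A B C D E F s u →
      ((q :* A :+ q :* B :+ E :* u :+ q :* F) :- (q :* M :+ q :* C :+ D :* u))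
        :+ (D :- E) :* (u :- q :* s) :+ q :* M
      := q :* (A :+ B :- C :- (D :- E) :* s :+ F)) refl
  lhs : ι (4 * M + 4 * (72 * k) + 16 * k ^ 2 * (5 * k + 2))
        ≡ ι 4 ℚ.* ι M ℚ.+ ι 4 ℚ.* ι (72 * k) ℚ.+ ι (16 * k ^ 2) ℚ.* ι (5 * k + 2)
  lhs = trans (ι-+ (4 * M + 4 * (72 * k)) (16 * k ^ 2 * (5 * k + 2)))
    (cong₂ ℚ._+_ (trans (ι-+ (4 * M) (4 * (72 * k))) (cong₂ ℚ._+_ (ι-* 4 M) (ι-* 4 (72 * k))))
                 (ι-* (16 * k ^ 2) (5 * k + 2)))
  rhs : ι (4 * (48 * k ^ 3) + 4 * (84 * k ^ 2) + 13 * (5 * k + 2) + 4 * 36)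
        ≡ ι 4 ℚ.* ι (48 * k ^ 3) ℚ.+ ι 4 ℚ.* ι (84 * k ^ 2) ℚ.+ ι 13 ℚ.* ι (5 * k + 2) ℚ.+ ι 4 ℚ.* ι 36
  rhs = trans (ι-+ (4 * (48 * k ^ 3) + 4 * (84 * k ^ 2) + 13 * (5 * k + 2)) (4 * 36))
    (cong₂ ℚ._+_
      (trans (ι-+ (4 * (48 * k ^ 3) + 4 * (84 * k ^ 2)) (13 * (5 * k + 2)))
        (cong₂ ℚ._+_
          (trans (ι-+ (4 * (48 * k ^ 3)) (4 * (84 * k ^ 2)))
            (cong₂ ℚ._+_ (ι-* 4 (48 * k ^ 3)) (ι-* 4 (84 * k ^ 2))))
          (ι-* 13 (5 * k + 2))))
      (ι-* 4 36))

-- Passage to the strict inequality between real numbers.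

0<ι : ∀ {n} → 0 < n → 0ℚ ℚ.< ι n
0<ι {n} 0<n = ℚ.<-≤-trans (ℚ.positive⁻¹ 1ℚ) (ι-mono 0<n)

0≤ι : ∀ n → 0ℚ ℚ.≤ ι n
0≤ι n = ι-mono {0} {n} z≤n

-- As D is at least 4cb, the quotient is at most 6n/b, and 6n + 1 ≤ ab in the integers leaves a gap
-- of 1/b, which is ε. Multiplying by 4cb replaces the divisions.
quotient-gap : ∀ c n a b D ε → 0 < c → 0 < b → 6 * n < a * b →
  ι (4 * c * b) ℚ.≤ D → ι b ℚ.* ε ≡ 1ℚ →
  ι (24 * c) ℚ.* inv D ℚ.* ι n ℚ.+ ε ℚ.≤ ι a
quotient-gap c n a b D ε 0<c 0<b 6n<ab M≤D bε≡1 =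
  ℚ.*-cancelʳ-≤-pos M {{ℚ.positive 0<M}} (begin
    (t ℚ.+ ε) ℚ.* M
      ≡⟨ ℚ.*-distribʳ-+ M t ε ⟩
    t ℚ.* M ℚ.+ ε ℚ.* M
      ≤⟨ ℚ.+-monoˡ-≤ (ε ℚ.* M) (ℚ.*-monoˡ-≤-nonNeg t {{ℚ.nonNegative 0≤t}} M≤D) ⟩
    t ℚ.* D ℚ.+ ε ℚ.* M
      ≡⟨ cong (λ x → t ℚ.* D ℚ.+ ε ℚ.* x) (ι-* (4 * c) b) ⟩
    t ℚ.* D ℚ.+ ε ℚ.* (ι (4 * c) ℚ.* ι b)
      ≡⟨ regroup (ι (24 * c)) (inv D) (ι n) D ε (ι (4 * c)) (ι b) ⟩
    ι (24 * c) ℚ.* ι n ℚ.* (D ℚ.* inv D) ℚ.+ ι (4 * c) ℚ.* (ι b ℚ.* ε)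
      ≡⟨ cong₂ (λ x y → ι (24 * c) ℚ.* ι n ℚ.* x ℚ.+ ι (4 * c) ℚ.* y) (inv-inverse D D≢0) bε≡1 ⟩
    ι (24 * c) ℚ.* ι n ℚ.* 1ℚ ℚ.+ ι (4 * c) ℚ.* 1ℚ
      ≡⟨ cong₂ ℚ._+_ (ℚ.*-identityʳ (ι (24 * c) ℚ.* ι n)) (ℚ.*-identityʳ (ι (4 * c))) ⟩
    ι (24 * c) ℚ.* ι n ℚ.+ ι (4 * c)
      ≡⟨ trans (ι-+ (24 * c * n) (4 * c)) (cong (ℚ._+ ι (4 * c)) (ι-* (24 * c) n)) ⟨
    ι (24 * c * n + 4 * c)
      ≤⟨ ι-mono (subst₂ _≤_ (lem₁ c n) (lem₂ c a b) (*-monoʳ-≤ (4 * c) 6n<ab)) ⟩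
    ι (a * (4 * c * b))
      ≡⟨ ι-* a (4 * c * b) ⟩
    ι a ℚ.* M ∎)
  where
  open ℚ.≤-Reasoning
  M t : ℚ
  M = ι (4 * c * b)
  t = ι (24 * c) ℚ.* inv D ℚ.* ι n
  0<M : 0ℚ ℚ.< M
  0<M = 0<ι (*-mono-< {0} {4 * c} {0} {b} (*-mono-< {0} {4} {0} {c} (s≤s z≤n) 0<c) 0<b)
  0<D : 0ℚ ℚ.< D
  0<D = ℚ.<-≤-trans 0<M M≤D
  D≢0 : D ≢ 0ℚ
  D≢0 D≡0 = ℚ.<⇒≢ 0<D (sym D≡0)
  0≤t : 0ℚ ℚ.≤ t
  0≤t = 0≤p*q (0≤p*q (0≤ι (24 * c)) (0≤inv 0<D)) (0≤ι n)
  regroup : ∀ x i n D ε c b →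
    x ℚ.* i ℚ.* n ℚ.* D ℚ.+ ε ℚ.* (c ℚ.* b) ≡ x ℚ.* n ℚ.* (D ℚ.* i) ℚ.+ c ℚ.* (b ℚ.* ε)
  regroup = solve 7 (λ x i n D ε c b →
    x :* i :* n :* D :+ ε :* (c :* b) := x :* n :* (D :* i) :+ c :* (b :* ε)) refl
  lem₁ : ∀ c n → 4 * c * suc (6 * n) ≡ 24 * c * n + 4 * c
  lem₁ = solve-∀
  lem₂ : ∀ c a b → 4 * c * (a * b) ≡ a * (4 * c * b)
  lem₂ = solve-∀

theorem3p5 : ∀ (k : ℕ) (2≤k : 2 ≤ k) (q : ℤ) →
    IsFloor ((-ʳ fromℕ 1 +ʳ √ (8 * k ∸ 7)) ÷ʳ fromℕ 2 [ fromℕ#0 2 ]) q →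
    ∀ (n : ℕ) (G : Graph n) → IsKTree k G →
    (+ k) ℤ.+ q ℤ.+ (+ 2) ℤ.≤ (+ n) →
    fromℕ (24 * k) ÷ʳ denominator k [ denominator#0 k 2≤k ] *ʳ fromℕ n
    <ʳ fromℕ (αreg G)
theorem3p5 k 2≤k _ _ n G T _ =
  let b = suc k * (7 * k + 5)
      -- `<ʳ` asks for one positive gap shared by all late terms; 1/b depends on k alone and serves
      -- from index 0 on.
      ε , 0<ε , bε≡1 = shrink (ι b) 1ℚ (0<ι 0<b) (ℚ.positive⁻¹ 1ℚ)
  in ε , 0<ε , 0 , λ m _ →
    quotient-gap k n (αreg G) b (seq (denominator k) m) ε 0<k 0<b
      (6n<αreg T {{>-nonZero 0<k}}) (≤denominator k 2≤k m) bε≡1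
  where
  0<k : 0 < k
  0<k = ≤-trans (s≤s z≤n) 2≤k
  0<b : 0 < suc k * (7 * k + 5)
  0<b = *-mono-< {0} {suc k} {0} {7 * k + 5} (s≤s z≤n) (m≤n⇒m≤o+n (7 * k) (s≤s z≤n))
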